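{- Let $n\ge 3$, let $F\subseteq E(K_n)$ be a set of $p\ge 1$ edges of the complete graph $K_n$, and assume that $K_n-F$ is connected. Let $Q$ be the edge-defect matrix of $F$, with eigenvalues $\theta_1,\ldots,\theta_p$ (with multiplicity, including zero eigenvalues). Then $$Kf(K_n-F)=n-1+\frac{2p}{n-2}+\frac{n}{(n-2)^2}\operatorname{tr}\left((Q-2I_p)^2(nI_p-Q)^{ -1}\right).$$ Equivalently, $$Kf(K_n-F)=n-1+\frac{2p}{n-2}+\frac{n}{(n-2)^2}\sum_{\alpha=1}^{p}\frac{(\theta_\alpha-2)^2}{n-\theta_\alpha}.$$
   Context: $K_n-F$ is the graph on the vertices of $K_n$ obtained by deleting the edges in $F=\{e_1,\ldots,e_p\}$. For each deleted edge $e_\alpha=\{u_\alpha,v_\alpha\}$ choose an arbitrary orientation and put $b_\alpha=e_{u_\alpha}-e_{v_\alpha}\in\mathbb{R}^n$, where $e_x$ is the standard basis vector of vertex $x$; put $B=[\,b_1\ \cdots\ b_p\,]$ (an $n\times p$ matrix). The edge-defect matrix of $F$ is the $p\times p$ matrix $Q=B^TB$. For a connected graph $G$ with Laplacian $L(G)=D(G)-A(G)$, the effective resistance between distinct vertices is $R_G(x,y)=(e_x-e_y)^TL(G)^+(e_x-e_y)$ ($L(G)^+$ the Moore--Penrose inverse), and the Kirchhoff index is $Kf(G)=\sum_{\{x,y\}}R_G(x,y)$, the sum over all unordered pairs of distinct vertices. -}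

module Defs where

open import Level using (Level; _⊔_; 0ℓ) renaming (suc to lsuc)
open import Data.Bool.Base using (if_then_else_)
open import Data.Nat.Base using (ℕ; zero; suc; _≤_; s≤s)
open import Data.Fin.Base using (Fin; zero; suc; toℕ; punchIn)
open import Data.Fin.Properties using (_≟_; _<?_; any?)
open import Data.Product.Base using (_×_; _,_; proj₁; ∃-syntax)
open import Data.Sum.Base using (_⊎_; inj₁; inj₂; [_,_]′)
open import Function.Base using (_∘_)
open import Relation.Nullary using (¬_; does; ¬?; _×-dec_; _⊎-dec_)
open import Relation.Binary.Core using (Rel)
open import Relation.Binary.Definitions using (Decidable; Symmetric)
open import Relation.Binary.Structures using (IsStrictPartialOrder)
open import Relation.Binary.PropositionalEquality as ≡ using (_≡_; _≢_)
open import Relation.Binary.Construct.Closure.ReflexiveTransitive using (Star)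
open import Algebra.Bundles using (CommutativeRing)
open import Algebra.Apartness.Bundles using (HeytingField; HeytingCommutativeRing)
import Algebra.Apartness.Properties.HeytingCommutativeRing as HCR
import Algebra.Properties.AbelianGroup
import Algebra.Properties.Ring
import Algebra.Properties.Semiring.Sum
import Algebra.Properties.Semiring.Mult
import Algebra.Properties.Semiring.Exp
import Algebra.Properties.Monoid.Sum

record SimpleGraph (n : ℕ) : Set₁ where
  field
    Adj    : Rel (Fin n) 0ℓ
    Adj?   : Decidable Adj
    sym    : Symmetric Adj
    irrefl : ∀ {x} → ¬ Adj x x

complete : (n : ℕ) → SimpleGraph n
complete n = record
  { Adj    = _≢_
  ; Adj?   = λ x y → ¬? (x ≟ y)
  ; sym    = λ x≢y → x≢y ∘ ≡.sym
  ; irrefl = λ x≢x → x≢x ≡.refl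
  }

Connected : ∀ {n} → SimpleGraph n → Set
Connected {n} G = ∀ (x y : Fin n) → Star (SimpleGraph.Adj G) x y

-- A set of p edges of G, enumerated without repetition, each with a chosen
-- orientation tail α ⟶ head α.  Distinctness is that of the underlying
-- unordered pairs.
record OrientedEdges {n : ℕ} (G : SimpleGraph n) (p : ℕ) : Set where
  field
    tail head : Fin p → Fin n

  Joins : Fin p → Fin n → Fin n → Set
  Joins α x y = (tail α ≡ x × head α ≡ y) ⊎ (tail α ≡ y × head α ≡ x)

  field
    isEdge   : ∀ α → SimpleGraph.Adj G (tail α) (head α)
    distinct : ∀ α β → Joins α (tail β) (head β) → α ≡ β

infixl 6 _∖_

_∖_ : ∀ {n p} (G : SimpleGraph n) → OrientedEdges G p → SimpleGraph n
G ∖ F = record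
  { Adj    = λ x y → Adj x y × ¬ (∃[ α ] Joins α x y)
  ; Adj?   = λ x y → Adj? x y ×-dec ¬? (any? λ α →
               ((tail α ≟ x) ×-dec (head α ≟ y)) ⊎-dec
               ((tail α ≟ y) ×-dec (head α ≟ x)))
  ; sym    = λ (xy , kept) → sym xy , λ (α , j) → kept (α , [ inj₂ , inj₁ ]′ j)
  ; irrefl = irrefl ∘ proj₁
  }
  where
  open SimpleGraph G
  open OrientedEdges F

-- Ordered fields, in the constructive sense: equality need not be decidable,
-- so that the real numbers are a model without any appeal to excluded middle.
record OrderedField (c ℓ₁ ℓ₂ ℓ₃ : Level) : Set (lsuc (c ⊔ ℓ₁ ⊔ ℓ₂ ⊔ ℓ₃)) where
  field
    heytingField : HeytingField c ℓ₁ ℓ₂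

  open HeytingField heytingField public

  infix 4 _<_

  field
    _<_                  : Rel Carrier ℓ₃
    isStrictPartialOrder : IsStrictPartialOrder _≈_ _<_
    #⇒<⊎>                : ∀ {x y} → x # y → x < y ⊎ y < x
    <⇒#                  : ∀ {x y} → x < y → x # y
    +-monoˡ-<            : ∀ {x y} z → x < y → x + z < y + z
    *-pos                : ∀ {x y} → 0# < x → 0# < y → 0# < x * y

  open HeytingCommutativeRing heytingCommutativeRing public
    using (commutativeRing)

module Over {c ℓ₁ ℓ₂ ℓ₃ : Level} (K : OrderedField c ℓ₁ ℓ₂ ℓ₃) where

  open OrderedField K hiding (zero) renaming (sym to ≈-sym)
  open CommutativeRing commutativeRing using (ring; semiring; *-monoid; +-abelianGroup)
  open Algebra.Properties.Semiring.Sum semiring public using (sum-syntax)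
  open Algebra.Properties.Monoid.Sum *-monoid public using ()
    renaming (sum to product)
  open Algebra.Properties.Semiring.Exp semiring public using (_^_)
  open Algebra.Properties.Semiring.Mult semiring using (×-homo-+)
    renaming (_×_ to _·_)

  fromℕ : ℕ → Carrier
  fromℕ k = k · 1#

  infixl 7 _/_⟨_⟩

  -- The library inverts y - 0#, which is ≈ y.
  _/_⟨_⟩ : Carrier → (y : Carrier) → y # 0# → Carrier
  x / y ⟨ y#0 ⟩ = x * proj₁ (#⇒invertible y#0)

  private
    open IsStrictPartialOrder isStrictPartialOrder
      using (<-respʳ-≈; <-respˡ-≈) renaming (trans to <-trans)
    open HCR heytingCommutativeRing using (1#0; x#0y#0→xy#0)
    open Algebra.Properties.AbelianGroup +-abelianGroup using (xyx⁻¹≈y)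
    open Algebra.Properties.Ring ring using (-1*x≈-x; -‿involutive)

    0<1 : 0# < 1#
    0<1 with #⇒<⊎> 1#0
    ... | inj₂ 0<1 = 0<1
    ... | inj₁ 1<0 = <-respʳ-≈ (trans (-1*x≈-x (- 1#)) (-‿involutive 1#)) (*-pos 0<-1 0<-1)
      where
      0<-1 : 0# < - 1#
      0<-1 = <-respˡ-≈ (-‿inverseʳ 1#) (<-respʳ-≈ (+-identityˡ (- 1#)) (+-monoˡ-< (- 1#) 1<0))

    0<fromℕ : ∀ k → 0# < fromℕ (suc k)
    0<fromℕ zero    = <-respʳ-≈ (≈-sym (+-identityʳ 1#)) 0<1
    0<fromℕ (suc k) = <-trans 0<1
      (<-respˡ-≈ (+-identityˡ 1#)
        (<-respʳ-≈ (+-comm (fromℕ (suc k)) 1#) (+-monoˡ-< 1# (0<fromℕ k))))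

  n-2#0 : ∀ {n} → 3 ≤ n → fromℕ n - fromℕ 2 # 0#
  n-2#0 {suc (suc (suc k))} (s≤s (s≤s (s≤s _))) =
    #-sym (<⇒# (<-respʳ-≈ (≈-sym n-2≈1+k) (0<fromℕ k)))
    where
    n-2≈1+k : fromℕ (suc (suc (suc k))) - fromℕ 2 ≈ fromℕ (suc k)
    n-2≈1+k = trans (+-congʳ (×-homo-+ 1# 2 (suc k))) (xyx⁻¹≈y (fromℕ 2) (fromℕ (suc k)))

  [n-2]²#0 : ∀ {n} → 3 ≤ n → (fromℕ n - fromℕ 2) ^ 2 # 0#
  [n-2]²#0 3≤n = x#0y#0→xy#0 (n-2#0 3≤n)
    (x#0y#0→xy#0 (n-2#0 3≤n) 1#0)

  Column : ℕ → Set c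
  Column n = Fin n → Carrier

  Matrix : ℕ → ℕ → Set c
  Matrix m n = Fin m → Fin n → Carrier

  infix  4 _≋_
  infixl 6 _⊖_
  infixl 7 _⊗_
  infixr 7 _⊙_
  infix  9 _ᵀ

  _≋_ : ∀ {m n} → Matrix m n → Matrix m n → Set ℓ₁
  A ≋ B = ∀ i j → A i j ≈ B i j

  I : ∀ {n} → Matrix n n
  I i j = if does (i ≟ j) then 1# else 0#

  _ᵀ : ∀ {m n} → Matrix m n → Matrix n m
  (A ᵀ) i j = A j i

  _⊖_ : ∀ {m n} → Matrix m n → Matrix m n → Matrix m n
  (A ⊖ B) i j = A i j - B i j

  _⊙_ : ∀ {m n} → Carrier → Matrix m n → Matrix m n
  (a ⊙ A) i j = a * A i j

  _⊗_ : ∀ {l m n} → Matrix l m → Matrix m n → Matrix l n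
  _⊗_ {m = m} A B i j = ∑[ k < m ] (A i k * B k j)

  tr : ∀ {n} → Matrix n n → Carrier
  tr {n} A = ∑[ i < n ] A i i

  -- Laplace expansion along the first row.
  det : ∀ {n} → Matrix n n → Carrier
  det {zero}  A = 1#
  det {suc n} A = ∑[ j < suc n ]
    ((- 1#) ^ toℕ j * A zero j * det (λ i k → A (suc i) (punchIn j k)))

  record Inverse {n : ℕ} (A : Matrix n n) : Set (c ⊔ ℓ₁) where
    field
      matrix   : Matrix n n
      inverseˡ : matrix ⊗ A ≋ I
      inverseʳ : A ⊗ matrix ≋ I

  -- The four Penrose equations; transposition plays the role of the adjoint, as
  -- for real scalars.  They determine the matrix uniquely.
  record MoorePenrose {m n : ℕ} (A : Matrix m n) : Set (c ⊔ ℓ₁) where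
    field
      matrix  : Matrix n m
      AXA≋A   : A ⊗ matrix ⊗ A ≋ A
      XAX≋X   : matrix ⊗ A ⊗ matrix ≋ matrix
      AX-symm : (A ⊗ matrix) ᵀ ≋ A ⊗ matrix
      XA-symm : (matrix ⊗ A) ᵀ ≋ matrix ⊗ A

  -- θ lists the roots of the characteristic polynomial det (x I - A) with
  -- multiplicity.  An ordered field is infinite, so agreement at every x is
  -- the same as equality of polynomials.
  Eigenvalues : ∀ {n} → Matrix n n → (Fin n → Carrier) → Set (c ⊔ ℓ₁)
  Eigenvalues A θ = ∀ x → det (x ⊙ I ⊖ A) ≈ product (λ α → x - θ α)

  e : ∀ {n} → Fin n → Column n
  e x i = I i x

  incidence : ∀ {n p} {G : SimpleGraph n} → OrientedEdges G p → Matrix n p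
  incidence F i α = e (tail α) i - e (head α) i
    where open OrientedEdges F

  edgeDefect : ∀ {n p} {G : SimpleGraph n} → OrientedEdges G p → Matrix p p
  edgeDefect F = incidence F ᵀ ⊗ incidence F

  adjacency : ∀ {n} → SimpleGraph n → Matrix n n
  adjacency G x y = if does (SimpleGraph.Adj? G x y) then 1# else 0#

  degreeMatrix : ∀ {n} → SimpleGraph n → Matrix n n
  degreeMatrix {n} G x y = (∑[ z < n ] adjacency G x z) * I x y

  laplacian : ∀ {n} → SimpleGraph n → Matrix n n
  laplacian G = degreeMatrix G ⊖ adjacency G

  module _ {n : ℕ} (G : SimpleGraph n) (L⁺ : MoorePenrose (laplacian G)) where

    effectiveResistance : Fin n → Fin n → Carrier
    effectiveResistance x y =
      ∑[ i < n ] ∑[ j < n ] (d i * MoorePenrose.matrix L⁺ i j * d j)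
      where
      d : Column n
      d i = e x i - e y i

    -- Unordered pairs {x , y} are represented by x < y.
    kirchhoffIndex : Carrier
    kirchhoffIndex = ∑[ x < n ] ∑[ y < n ]
      (if does (x <? y) then effectiveResistance x y else 0#)

module Submission where

-- Put A = L + J for the Laplacian L of K_n - F.  Then A = n I - B Bᵀ, and A is
-- positive definite because the graph is connected, so it has an inverse C and
-- L⁺ = C - J/n².  This gives Kf = n tr L⁺ = n tr C - 1.  By the push-through
-- identity n I - Q has the inverse M = (I + Bᵀ C B)/n, whence
-- n tr M = p + n tr C - n; the trace formula follows by expanding
-- Q - 2 I = (n - 2) I - (n I - Q).
--
-- For the eigenvalues, det (A + t X) = det A (1 + t tr (A⁻¹ X) + O(t²)) by Cramer's
-- rule.  Comparing the linear coefficients of det (x I - Q) = ∏ (x - θ) at x = n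
-- and at x = ∞ yields tr M = ∑ 1/(n - θ) and tr Q = ∑ θ.

-- Equality in the field is not decidable, so elimination cannot search for a nonzero pivot, and
-- every division needs a proof of apartness. Positive definiteness supplies it: each pivot is the
-- value of the quadratic form at a vector with an entry apart from zero. The identity for A holds
-- because K_n has Laplacian n I - J and deleting F subtracts B Bᵀ, the Laplacian of the deleted
-- edges. L itself is singular on the constant vectors, and J repairs exactly that. The θ are given
-- only through the characteristic polynomial, and eigenvectors cannot be chosen without deciding
-- which roots coincide. Hence ∑ 1/(n - θ) and ∑ θ are read off as logarithmic derivatives of
-- polynomial functions. The shift by 2 comes from the diagonal of Q: every column of B has squared
-- length 2, so Q - 2 I has trace zero and the linear term of the expansion drops out.

open import Defs
open import Level using (Level; _⊔_)
open import Data.Bool.Base using (if_then_else_)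
open import Data.Fin.Base using (Fin; zero; suc; toℕ; punchIn; punchOut; inject₁)
open import Data.Fin.Properties using (_≟_; _<?_; any?; <-cmp; suc-injective; toℕ-injective; toℕ-inject₁; punchIn-injective; punchInᵢ≢i; punchIn-punchOut)
open import Data.Integer.Base as ℤ using (ℤ; +_; -[1+_])
import Data.Integer.Properties as ℤ
open import Data.List.Base as List using (List; []; _∷_; length)
import Data.List.Properties as List
open import Data.Maybe.Base using (just; nothing)
open import Data.Nat.Base as ℕ using (ℕ; suc; _≤_)
import Data.Nat.Properties as ℕ
open import Data.Product.Base using (Σ-syntax; ∃-syntax; _×_; _,_; proj₁; proj₂)
open import Data.Sum.Base using (_⊎_; inj₁; inj₂; reduce)
open import Data.Vec.Functional using (updateAt)
open import Data.Vec.Functional.Properties using (updateAt-updates; updateAt-minimal)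
open import Function.Base using (_∘_)
open import Relation.Nullary using (Dec; ¬_; yes; no; does; contradiction; _×-dec_; _⊎-dec_)
open import Relation.Binary.Definitions using (WeaklyDecidable; tri<; tri≈; tri>)
open import Relation.Binary.Structures using (IsStrictPartialOrder)
open import Relation.Binary.PropositionalEquality as ≡ using (_≡_; _≢_)
open import Relation.Binary.Construct.Closure.ReflexiveTransitive using (Star; ε; _◅_)
open import Algebra.Bundles using (CommutativeRing)
open import Algebra.Solver.Ring.AlmostCommutativeRing using (AlmostCommutativeRing; fromCommutativeRing; _-Raw-AlmostCommutative⟶_; Induced-equivalence)
import Algebra.Apartness.Properties.HeytingCommutativeRing
import Algebra.Properties.AbelianGroup
import Algebra.Properties.Monoid.Sum
import Algebra.Properties.Ring
import Algebra.Properties.Semiring.Mult.TCOptimised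
import Algebra.Properties.Semiring.Sum
import Algebra.Solver.Ring
import Relation.Binary.Reasoning.Setoid

-- The ring solver needs coefficients with decidable equality, which a general
-- ring does not have: the integers serve for every commutative ring.
module IntegerCoefficients {c ℓ} (R : CommutativeRing c ℓ) where

  open CommutativeRing R
  open Algebra.Properties.Ring ring using (-‿involutive; -‿distribˡ-*; -‿distribʳ-*; -0#≈0#)
  open Algebra.Properties.AbelianGroup +-abelianGroup using (⁻¹-∙-comm)
  open Algebra.Properties.Semiring.Mult.TCOptimised semiring using (1+×; ×-homo-+; ×1-homo-*)
    renaming (_×_ to _·_)
  open Relation.Binary.Reasoning.Setoid setoid

  private
    -- With the type-checking optimised multiple, the images of 0, 1 and 2 compute to `0#`, `1#` and
    -- `1# + 1#`, so literals `con` in solver calls match these terms directly.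
    ι : ℤ → Carrier
    ι (+ n)    = n · 1#
    ι -[1+ n ] = - (suc n · 1#)

    cancel : ∀ x y → (1# + x) - (1# + y) ≈ x - y
    cancel x y = begin
      (1# + x) - (1# + y)       ≈⟨ +-cong (+-comm 1# x) (sym (⁻¹-∙-comm 1# y)) ⟩
      (x + 1#) + (- 1# - y)     ≈⟨ +-assoc x 1# _ ⟩
      x + (1# + (- 1# - y))     ≈⟨ +-congˡ (+-assoc 1# (- 1#) (- y)) ⟨
      x + ((1# - 1#) - y)       ≈⟨ +-congˡ (+-congʳ (-‿inverseʳ 1#)) ⟩
      x + (0# - y)              ≈⟨ +-congˡ (+-identityˡ (- y)) ⟩
      x - y                     ∎

    ι-⊖ : ∀ m n → ι (m ℤ.⊖ n) ≈ m · 1# - n · 1#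
    ι-⊖ ℕ.zero    ℕ.zero    = sym (-‿inverseʳ 0#)
    ι-⊖ ℕ.zero    (suc n) = sym (+-identityˡ _)
    ι-⊖ (suc m) ℕ.zero    = sym (trans (+-congˡ -0#≈0#) (+-identityʳ _))
    ι-⊖ (suc m) (suc n) = begin
      ι (suc m ℤ.⊖ suc n)                ≡⟨ ≡.cong ι (ℤ.[1+m]⊖[1+n]≡m⊖n m n) ⟩
      ι (m ℤ.⊖ n)                        ≈⟨ ι-⊖ m n ⟩
      m · 1# - n · 1#                  ≈⟨ cancel _ _ ⟨
      (1# + m · 1#) - (1# + n · 1#)    ≈⟨ +-cong (1+× m 1#) (-‿cong (1+× n 1#)) ⟨
      suc m · 1# - suc n · 1#          ∎

    ι-neg : ∀ i → ι (ℤ.- i) ≈ - ι i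
    ι-neg (+ ℕ.zero)  = sym -0#≈0#
    ι-neg (+ suc n) = refl
    ι-neg -[1+ n ]  = sym (-‿involutive _)

    ι-+ : ∀ i j → ι (i ℤ.+ j) ≈ ι i + ι j
    ι-+ (+ m)    (+ n)    = ×-homo-+ 1# m n
    ι-+ (+ m)    -[1+ n ] = ι-⊖ m (suc n)
    ι-+ -[1+ m ] (+ n)    = trans (ι-⊖ n (suc m)) (+-comm _ _)
    ι-+ -[1+ m ] -[1+ n ] = trans (-‿cong (trans (1+× (suc (m ℕ.+ n)) 1#) (trans (+-congˡ (×-homo-+ 1# (suc m) n)) rearranged))) (sym (⁻¹-∙-comm _ _))
      where
      rearranged : 1# + (suc m · 1# + n · 1#) ≈ suc m · 1# + suc n · 1#
      rearranged = begin
        1# + (suc m · 1# + n · 1#)   ≈⟨ +-assoc _ _ _ ⟨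
        (1# + suc m · 1#) + n · 1#   ≈⟨ +-congʳ (+-comm _ _) ⟩
        (suc m · 1# + 1#) + n · 1#   ≈⟨ +-assoc _ _ _ ⟩
        suc m · 1# + (1# + n · 1#)   ≈⟨ +-congˡ (1+× n 1#) ⟨
        suc m · 1# + suc n · 1#      ∎

    ι-*-+ : ∀ m j → ι (+ m ℤ.* j) ≈ ι (+ m) * ι j
    ι-*-+ m (+ n) = trans (reflexive (≡.cong ι (≡.sym (ℤ.pos-* m n)))) (×1-homo-* m n)
    ι-*-+ m -[1+ n ] = begin
      ι (+ m ℤ.* ℤ.- (+ suc n))     ≡⟨ ≡.cong ι (ℤ.neg-distribʳ-* (+ m) (+ suc n)) ⟨
      ι (ℤ.- (+ m ℤ.* + suc n))     ≈⟨ ι-neg (+ m ℤ.* + suc n) ⟩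
      - ι (+ m ℤ.* + suc n)         ≈⟨ -‿cong (ι-*-+ m (+ suc n)) ⟩
      - (ι (+ m) * ι (+ suc n))     ≈⟨ -‿distribʳ-* _ _ ⟩
      ι (+ m) * ι -[1+ n ]          ∎

    ι-* : ∀ i j → ι (i ℤ.* j) ≈ ι i * ι j
    ι-* (+ m)    j = ι-*-+ m j
    ι-* -[1+ m ] j = begin
      ι (ℤ.- (+ suc m) ℤ.* j)       ≡⟨ ≡.cong ι (ℤ.neg-distribˡ-* (+ suc m) j) ⟨
      ι (ℤ.- (+ suc m ℤ.* j))       ≈⟨ ι-neg (+ suc m ℤ.* j) ⟩
      - ι (+ suc m ℤ.* j)           ≈⟨ -‿cong (ι-*-+ (suc m) j) ⟩
      - (ι (+ suc m) * ι j)         ≈⟨ -‿distribˡ-* _ _ ⟩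
      ι -[1+ m ] * ι j              ∎

    almostRing : AlmostCommutativeRing c ℓ
    almostRing = fromCommutativeRing R

    ι-morphism : ℤ.+-*-rawRing -Raw-AlmostCommutative⟶ almostRing
    ι-morphism = record
      { ⟦_⟧    = ι
      ; +-homo = ι-+
      ; *-homo = ι-*
      ; -‿homo = ι-neg
      ; 0-homo = refl
      ; 1-homo = refl
      }

    ι-≟ : WeaklyDecidable (Induced-equivalence ι-morphism)
    ι-≟ i j with i ℤ.≟ j
    ... | yes i≡j = just (reflexive (≡.cong ι i≡j))
    ... | no _    = nothing

  open Algebra.Solver.Ring ℤ.+-*-rawRing almostRing ι-morphism ι-≟ public
    using (solve; _:=_; _:+_; _:*_; _:-_; :-_; con)

-- Effect of deleting one column on two adjacent ones.

-- Two neighbouring columns stay neighbours when another column is removed. A minor therefore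
-- inherits a pair of equal adjacent columns.
punchIn-off-adjacent : ∀ {n} (i : Fin (suc n)) (j : Fin (suc (suc n))) → j ≢ inject₁ i → j ≢ suc i →
                       ∃[ i′ ] (punchIn j (inject₁ i′) ≡ inject₁ i × punchIn j (suc i′) ≡ suc i)
punchIn-off-adjacent zero zero j≢0 _ = contradiction ≡.refl j≢0
punchIn-off-adjacent zero (suc zero) _ j≢1 = contradiction ≡.refl j≢1
punchIn-off-adjacent {suc n} zero (suc (suc j)) _ _ = zero , ≡.refl , ≡.refl
punchIn-off-adjacent {suc n} (suc i) zero _ _ = i , ≡.refl , ≡.refl
punchIn-off-adjacent {suc n} (suc i) (suc j) j≢i j≢1+i
  with punchIn-off-adjacent i j (j≢i ∘ ≡.cong suc) (j≢1+i ∘ ≡.cong suc)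
... | i′ , eq , eq′ = suc i′ , ≡.cong suc eq , ≡.cong suc eq′

-- Deleting either of two neighbours leaves the same columns except in the one slot taken by the
-- surviving neighbour. If the neighbours are equal, the two minors coincide.
punchIn-adjacent : ∀ {n} (i k : Fin n) → punchIn (inject₁ i) k ≡ punchIn (suc i) k ⊎
                   (punchIn (inject₁ i) k ≡ suc i × punchIn (suc i) k ≡ inject₁ i)
punchIn-adjacent zero    zero    = inj₂ (≡.refl , ≡.refl)
punchIn-adjacent zero    (suc k) = inj₁ ≡.refl
punchIn-adjacent (suc i) zero    = inj₁ ≡.refl
punchIn-adjacent (suc i) (suc k) with punchIn-adjacent i k
... | inj₁ eq         = inj₁ (≡.cong suc eq)
... | inj₂ (eq , eq′) = inj₂ (≡.cong suc eq , ≡.cong suc eq′)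

inject₁≢suc : ∀ {n} (i : Fin n) → inject₁ i ≢ suc i
inject₁≢suc zero    ()
inject₁≢suc (suc i) eq = inject₁≢suc i (suc-injective eq)

module _ {c ℓ₁ ℓ₂ ℓ₃ : Level} (K : OrderedField c ℓ₁ ℓ₂ ℓ₃) where

  open OrderedField K hiding (zero) renaming (sym to ≈-sym)
  open CommutativeRing commutativeRing using (ring; semiring; *-monoid)
  open Over K
  open Algebra.Properties.Ring ring using (-0#≈0#)
  open Algebra.Apartness.Properties.HeytingCommutativeRing heytingCommutativeRing
    using (1#0; x#0y#0→xy#0; x-0≈x; #-congʳ; invertibleˡ⇒#)
  open IsStrictPartialOrder isStrictPartialOrder
    using (<-respʳ-≈; <-respˡ-≈) renaming (trans to <-trans; irrefl to <-irrefl)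
  open Algebra.Properties.Semiring.Sum semiring
    using (sum; sum-cong-≋; sum-remove; ∑-distrib-+; ∑-comm; *-distribˡ-sum; *-distribʳ-sum; sum-replicate-zero)
  open Algebra.Properties.Monoid.Sum *-monoid using () renaming (sum-cong-≋ to product-cong)
  open IntegerCoefficients commutativeRing
  open Relation.Binary.Reasoning.Setoid setoid

  -- Ordered fields

  -- Apartness amounts to invertibility of the difference, so it depends on the difference alone.
  #-resp-difference : ∀ {x y u v} → x - y ≈ u - v → x # y → u # v
  #-resp-difference {x} {y} {u} {v} eq x#y with #⇒invertible x#y
  ... | z , z[x-y]≈1 , _ = invertibleˡ⇒# (z , trans (*-congˡ (≈-sym eq)) z[x-y]≈1)

  -- Cotransitivity at y: either x + y is apart from y, which makes x apart from zero, or y is apart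
  -- from zero. This replaces case distinctions on whether a number vanishes.
  +-#0 : ∀ {x y} → x + y # 0# → x # 0# ⊎ y # 0#
  +-#0 {x} {y} x+y#0 with #-cotrans x+y#0 y
  ... | inj₁ x+y#y = inj₁ (#-resp-difference (solve 2 (λ x y → x :+ y :- y := x :- con (+ 0)) refl x y) x+y#y)
  ... | inj₂ y#0   = inj₂ y#0

  -- If z inverts x y, then z y inverts x.
  *-#0ˡ : ∀ {x y} → x * y # 0# → x # 0#
  *-#0ˡ {x} {y} xy#0 with #⇒invertible xy#0
  ... | z , z[xy]≈1 , _ = invertibleˡ⇒# (z * y , trans (solve 3 (λ x y z → z :* y :* (x :- con (+ 0)) := z :* (x :* y :- con (+ 0))) refl x y z) z[xy]≈1)

  *-#0ʳ : ∀ {x y} → x * y # 0# → y # 0#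
  *-#0ʳ {x} {y} xy#0 = *-#0ˡ (#-congʳ (*-comm x y) xy#0)

  sum-#0 : ∀ {n} (f : Fin n → Carrier) → sum f # 0# → ∃[ i ] f i # 0#
  sum-#0 {ℕ.zero} f 0#0 = contradiction 0#0 (#-irrefl refl)
  sum-#0 {suc n}  f ∑#0 with +-#0 ∑#0
  ... | inj₁ f₀#0 = zero , f₀#0
  ... | inj₂ ∑′#0 with sum-#0 (f ∘ suc) ∑′#0
  ...   | i , fᵢ#0 = suc i , fᵢ#0

  inverse : ∀ {x} → x # 0# → Carrier
  inverse x#0 = proj₁ (#⇒invertible x#0)

  *-inverseʳ : ∀ {x} (x#0 : x # 0#) → x * inverse x#0 ≈ 1#
  *-inverseʳ {x} x#0 = trans (*-congʳ (≈-sym (x-0≈x x))) (proj₂ (proj₂ (#⇒invertible x#0)))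

  *-cancelˡ : ∀ {x y z} → x # 0# → x * y ≈ x * z → y ≈ z
  *-cancelˡ {x} {y} {z} x#0 xy≈xz = begin
    y                         ≈⟨ unit y ⟨
    inverse x#0 * (x * y)     ≈⟨ *-congˡ xy≈xz ⟩
    inverse x#0 * (x * z)     ≈⟨ unit z ⟩
    z                         ∎
    where
    unit : ∀ w → inverse x#0 * (x * w) ≈ w
    unit w = begin
      inverse x#0 * (x * w)   ≈⟨ solve 3 (λ i x w → i :* (x :* w) := x :* i :* w) refl _ x w ⟩
      x * inverse x#0 * w     ≈⟨ *-congʳ (*-inverseʳ x#0) ⟩
      1# * w                  ≈⟨ *-identityˡ w ⟩
      w                       ∎

  >⇒#0 : ∀ {x} → 0# < x → x # 0#
  >⇒#0 0<x = #-sym (<⇒# 0<x)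

  neg-pos : ∀ {x} → x < 0# → 0# < - x
  neg-pos {x} x<0 = <-respˡ-≈ (-‿inverseʳ x) (<-respʳ-≈ (+-identityˡ (- x)) (+-monoˡ-< (- x) x<0))

  x#0⇒0<x² : ∀ {x} → x # 0# → 0# < x * x
  x#0⇒0<x² {x} x#0 with #⇒<⊎> x#0
  ... | inj₁ x<0 = <-respʳ-≈ (solve 1 (λ x → :- x :* :- x := x :* x) refl x) (*-pos (neg-pos x<0) (neg-pos x<0))
  ... | inj₂ 0<x = *-pos 0<x 0<x

  0<1 : 0# < 1#
  0<1 = <-respʳ-≈ (*-identityˡ 1#) (x#0⇒0<x² 1#0)

  +-pos : ∀ {x y} → 0# < x → 0# < y → 0# < x + y
  +-pos {x} {y} 0<x 0<y = <-trans 0<y (<-respˡ-≈ (+-identityˡ y) (+-monoˡ-< y 0<x))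

  0<fromℕ : ∀ k → 0# < fromℕ (suc k)
  0<fromℕ ℕ.zero  = <-respʳ-≈ (≈-sym (+-identityʳ 1#)) 0<1
  0<fromℕ (suc k) = +-pos 0<1 (0<fromℕ k)

  2# : Carrier
  2# = 1# + 1#

  2#0 : 2# # 0#
  2#0 = >⇒#0 (+-pos 0<1 0<1)

  fromℕ2≈2# : fromℕ 2 ≈ 2#
  fromℕ2≈2# = +-congˡ (+-identityʳ 1#)

  -- The weak order is a negation, so that squares and sums of squares qualify without deciding
  -- whether they are zero.
  NonNegative : Carrier → Set ℓ₃
  NonNegative x = ¬ (x < 0#)

  NonNegative-resp-≈ : ∀ {x y} → x ≈ y → NonNegative x → NonNegative y
  NonNegative-resp-≈ x≈y 0≤x y<0 = 0≤x (<-respˡ-≈ (≈-sym x≈y) y<0)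

  0-nonNeg : NonNegative 0#
  0-nonNeg = <-irrefl refl

  pos⇒nonNeg : ∀ {x} → 0# < x → NonNegative x
  pos⇒nonNeg 0<x x<0 = <-irrefl refl (<-trans 0<x x<0)

  -- Cotransitivity places x + y apart from 0 or apart from x. In either case the wrong orientation
  -- of the inequality would force y below zero.
  pos+nonNeg : ∀ {x y} → 0# < x → NonNegative y → 0# < x + y
  pos+nonNeg {x} {y} 0<x 0≤y with #-cotrans (<⇒# 0<x) (x + y)
  ... | inj₁ 0#x+y with #⇒<⊎> 0#x+y
  ...   | inj₁ 0<x+y = 0<x+y
  ...   | inj₂ x+y<0 = contradiction
    (<-respˡ-≈ (solve 2 (λ x y → x :+ y :+ :- x := y) refl x y)
      (<-trans (+-monoˡ-< (- x) x+y<0)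
        (<-respʳ-≈ (-‿inverseʳ x) (+-monoˡ-< (- x) 0<x))))
    0≤y
  pos+nonNeg {x} {y} 0<x 0≤y | inj₂ x+y#x with #⇒<⊎> x+y#x
  ... | inj₁ x+y<x = contradiction
    (<-respˡ-≈ (solve 2 (λ x y → x :+ y :+ :- x := y) refl x y)
      (<-respʳ-≈ (-‿inverseʳ x) (+-monoˡ-< (- x) x+y<x)))
    0≤y
  ... | inj₂ x<x+y = <-trans 0<x x<x+y

  nonNeg-#0⇒pos : ∀ {x} → NonNegative x → x # 0# → 0# < x
  nonNeg-#0⇒pos 0≤x x#0 with #⇒<⊎> x#0
  ... | inj₁ x<0 = contradiction x<0 0≤x
  ... | inj₂ 0<x = 0<x

  -- A negative sum is apart from zero, so one summand is too; that summand is then positive, and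
  -- `pos+nonNeg` makes the sum positive.
  +-nonNeg : ∀ {x y} → NonNegative x → NonNegative y → NonNegative (x + y)
  +-nonNeg {x} {y} 0≤x 0≤y x+y<0 with +-#0 (<⇒# x+y<0)
  ... | inj₁ x#0 = pos⇒nonNeg (pos+nonNeg (nonNeg-#0⇒pos 0≤x x#0) 0≤y) x+y<0
  ... | inj₂ y#0 = pos⇒nonNeg (pos+nonNeg (nonNeg-#0⇒pos 0≤y y#0) 0≤x) (<-respˡ-≈ (+-comm x y) x+y<0)

  square-nonNeg : ∀ x → NonNegative (x * x)
  square-nonNeg x x²<0 = pos⇒nonNeg (x#0⇒0<x² (*-#0ˡ (<⇒# x²<0))) x²<0

  sum-nonNeg : ∀ {n} (f : Fin n → Carrier) → (∀ i → NonNegative (f i)) → NonNegative (sum f)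
  sum-nonNeg {ℕ.zero} f 0≤f = 0-nonNeg
  sum-nonNeg {suc n}  f 0≤f = +-nonNeg (0≤f zero) (sum-nonNeg (f ∘ suc) (0≤f ∘ suc))

  sum-pos : ∀ {n} (f : Fin n → Carrier) → (∀ i → NonNegative (f i)) → ∀ i → 0# < f i → 0# < sum f
  sum-pos {suc n} f 0≤f i 0<fᵢ = <-respʳ-≈ (≈-sym (sum-remove {i = i} f))
    (pos+nonNeg 0<fᵢ (sum-nonNeg (f ∘ punchIn i) (0≤f ∘ punchIn i)))

  -- The Laplacian form becomes a sum of squares only after doubling; this and the next lemma undo
  -- the doubling.
  x+x-nonNeg⇒nonNeg : ∀ {x} → NonNegative (x + x) → NonNegative x
  x+x-nonNeg⇒nonNeg {x} 0≤x+x x<0 = 0≤x+x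
    (<-trans (<-respʳ-≈ (+-identityˡ x) (+-monoˡ-< x x<0)) x<0)

  x+x-pos⇒pos : ∀ {x} → 0# < x + x → 0# < x
  x+x-pos⇒pos {x} 0<x+x = nonNeg-#0⇒pos (x+x-nonNeg⇒nonNeg (pos⇒nonNeg 0<x+x))
    (reduce (+-#0 (>⇒#0 0<x+x)))

  -- Sums and matrices

  sum-zero : ∀ {n} (f : Fin n → Carrier) → (∀ i → f i ≈ 0#) → sum f ≈ 0#
  sum-zero {n} f f≈0 = trans (sum-cong-≋ f≈0) (sum-replicate-zero n)

  sum-single : ∀ {n} (f : Fin n → Carrier) i → (∀ k → k ≢ i → f k ≈ 0#) → sum f ≈ f i
  sum-single {suc n} f i f≈0 = begin
    sum f                            ≈⟨ sum-remove {i = i} f ⟩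
    f i + sum (λ k → f (punchIn i k))  ≈⟨ +-congˡ (sum-zero _ (λ k → f≈0 _ (punchInᵢ≢i i k))) ⟩
    f i + 0#                         ≈⟨ +-identityʳ (f i) ⟩
    f i                              ∎

  sum-neg : ∀ {n} (f : Fin n → Carrier) → ∑[ i < n ] (- f i) ≈ - sum f
  sum-neg {ℕ.zero} f = ≈-sym -0#≈0#
  sum-neg {suc n}  f = trans (+-congˡ (sum-neg (f ∘ suc))) (solve 2 (λ x y → :- x :+ :- y := :- (x :+ y)) refl _ _)

  sum-minus : ∀ {n} (f g : Fin n → Carrier) → ∑[ i < n ] (f i - g i) ≈ sum f - sum g
  sum-minus f g = trans (∑-distrib-+ f (λ i → - g i)) (+-congˡ (sum-neg g))

  sum-const : ∀ n x → ∑[ i < n ] x ≈ fromℕ n * x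
  sum-const ℕ.zero  x = ≈-sym (zeroˡ x)
  sum-const (suc n) x = trans (+-congˡ (sum-const n x)) (solve 2 (λ k x → x :+ k :* x := (con (+ 1) :+ k) :* x) refl (fromℕ n) x)

  I-≡ : ∀ {n} {i j : Fin n} → i ≡ j → I i j ≈ 1#
  I-≡ {i = i} {j} i≡j with i ≟ j
  ... | yes _  = refl
  ... | no i≢j = contradiction i≡j i≢j

  I-≢ : ∀ {n} {i j : Fin n} → i ≢ j → I i j ≈ 0#
  I-≢ {i = i} {j} i≢j with i ≟ j
  ... | yes i≡j = contradiction i≡j i≢j
  ... | no _    = refl

  I-sym : ∀ {n} (i j : Fin n) → I i j ≈ I j i
  I-sym i j with i ≟ j
  ... | yes i≡j = ≈-sym (I-≡ (≡.sym i≡j))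
  ... | no i≢j  = ≈-sym (I-≢ (i≢j ∘ ≡.sym))

  sum-Iˡ : ∀ {n} (f : Fin n → Carrier) i → ∑[ k < n ] (I i k * f k) ≈ f i
  sum-Iˡ f i = begin
    sum (λ k → I i k * f k)  ≈⟨ sum-single _ i (λ k k≢i → trans (*-congʳ (I-≢ (k≢i ∘ ≡.sym))) (zeroˡ _)) ⟩
    I i i * f i              ≈⟨ *-congʳ (I-≡ {i = i} ≡.refl) ⟩
    1# * f i                 ≈⟨ *-identityˡ (f i) ⟩
    f i                      ∎

  sum-Iʳ : ∀ {n} (f : Fin n → Carrier) j → ∑[ k < n ] (f k * I k j) ≈ f j
  sum-Iʳ f j = trans (sum-cong-≋ (λ k → trans (*-comm _ _) (*-congʳ (I-sym k j)))) (sum-Iˡ f j)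

  infixl 7 _⊛_ _∙_

  _⊛_ : ∀ {m n} → Matrix m n → Column n → Column m
  _⊛_ {n = n} A x i = ∑[ k < n ] (A i k * x k)

  _∙_ : ∀ {n} → Column n → Column n → Carrier
  _∙_ {n} x y = ∑[ i < n ] (x i * y i)

  ⊛-assoc : ∀ {l m n} (A : Matrix l m) (B : Matrix m n) (x : Column n) i →
            (A ⊗ B ⊛ x) i ≈ (A ⊛ (B ⊛ x)) i
  ⊛-assoc {l} {m} {n} A B x i = begin
    ∑[ j < n ] ((∑[ k < m ] (A i k * B k j)) * x j)   ≈⟨ sum-cong-≋ (λ j → *-distribʳ-sum (x j) (λ k → A i k * B k j)) ⟩
    ∑[ j < n ] ∑[ k < m ] (A i k * B k j * x j)       ≈⟨ ∑-comm (λ j k → A i k * B k j * x j) ⟩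
    ∑[ k < m ] ∑[ j < n ] (A i k * B k j * x j)       ≈⟨ sum-cong-≋ (λ k → sum-cong-≋ (λ j → *-assoc (A i k) (B k j) (x j))) ⟩
    ∑[ k < m ] ∑[ j < n ] (A i k * (B k j * x j))     ≈⟨ sum-cong-≋ (λ k → *-distribˡ-sum (A i k) (λ j → B k j * x j)) ⟨
    ∑[ k < m ] (A i k * (∑[ j < n ] (B k j * x j)))   ∎

  ⊛-congʳ : ∀ {m n} {A B : Matrix m n} (x : Column n) → A ≋ B → ∀ i → (A ⊛ x) i ≈ (B ⊛ x) i
  ⊛-congʳ x A≋B i = sum-cong-≋ (λ k → *-congʳ (A≋B i k))

  ⊗-cong : ∀ {l m n} {A A′ : Matrix l m} {B B′ : Matrix m n} → A ≋ A′ → B ≋ B′ → A ⊗ B ≋ A′ ⊗ B′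
  ⊗-cong A≋A′ B≋B′ i j = sum-cong-≋ (λ k → *-cong (A≋A′ i k) (B≋B′ k j))

  ⊗-congˡ : ∀ {l m n} (A : Matrix l m) {B B′ : Matrix m n} → B ≋ B′ → A ⊗ B ≋ A ⊗ B′
  ⊗-congˡ A = ⊗-cong {A = A} (λ _ _ → refl)

  ⊗-congʳ : ∀ {l m n} {A A′ : Matrix l m} (B : Matrix m n) → A ≋ A′ → A ⊗ B ≋ A′ ⊗ B
  ⊗-congʳ B A≋A′ = ⊗-cong {B = B} A≋A′ (λ _ _ → refl)

  ⊗-assoc : ∀ {k l m n} (A : Matrix k l) (B : Matrix l m) (C : Matrix m n) → A ⊗ B ⊗ C ≋ A ⊗ (B ⊗ C)
  ⊗-assoc A B C i j = ⊛-assoc A B (λ k → C k j) i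

  ⊗-identityˡ : ∀ {m n} (A : Matrix m n) → I ⊗ A ≋ A
  ⊗-identityˡ A i j = sum-Iˡ (λ k → A k j) i

  ⊗-identityʳ : ∀ {m n} (A : Matrix m n) → A ⊗ I ≋ A
  ⊗-identityʳ A i j = sum-Iʳ (A i) j

  ⊗-ᵀ : ∀ {l m n} (A : Matrix l m) (B : Matrix m n) → (A ⊗ B) ᵀ ≋ B ᵀ ⊗ A ᵀ
  ⊗-ᵀ A B i j = sum-cong-≋ (λ k → *-comm (A j k) (B k i))

  ⊗-⊙⊖ : ∀ {l m n} (X : Matrix l m) a (Y Z : Matrix m n) → X ⊗ (a ⊙ Y ⊖ Z) ≋ a ⊙ (X ⊗ Y) ⊖ X ⊗ Z
  ⊗-⊙⊖ {m = m} X a Y Z i j = begin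
    ∑[ k < m ] (X i k * (a * Y k j - Z k j))              ≈⟨ sum-cong-≋ {m} (λ k → solve 4 (λ x a y z → x :* (a :* y :- z) := a :* (x :* y) :- x :* z) refl (X i k) a (Y k j) (Z k j)) ⟩
    ∑[ k < m ] (a * (X i k * Y k j) - X i k * Z k j)      ≈⟨ sum-minus (λ k → a * (X i k * Y k j)) (λ k → X i k * Z k j) ⟩
    ∑[ k < m ] (a * (X i k * Y k j)) - (X ⊗ Z) i j        ≈⟨ +-congʳ (*-distribˡ-sum a (λ k → X i k * Y k j)) ⟨
    a * (X ⊗ Y) i j - (X ⊗ Z) i j                         ∎

  ⊙⊖-⊗ : ∀ {l m n} a (Y Z : Matrix l m) (X : Matrix m n) → (a ⊙ Y ⊖ Z) ⊗ X ≋ a ⊙ (Y ⊗ X) ⊖ Z ⊗ X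
  ⊙⊖-⊗ a Y Z X i j = begin
    ((a ⊙ Y ⊖ Z) ⊗ X) i j                         ≈⟨ ⊗-ᵀ (a ⊙ Y ⊖ Z) X j i ⟩
    (X ᵀ ⊗ (a ⊙ Y ᵀ ⊖ Z ᵀ)) j i                   ≈⟨ ⊗-⊙⊖ (X ᵀ) a (Y ᵀ) (Z ᵀ) j i ⟩
    a * (X ᵀ ⊗ Y ᵀ) j i - (X ᵀ ⊗ Z ᵀ) j i         ≈⟨ +-cong (*-congˡ (⊗-ᵀ Y X j i)) (-‿cong (⊗-ᵀ Z X j i)) ⟨
    a * (Y ⊗ X) i j - (Z ⊗ X) i j                 ∎

  [⊙I⊖]⊗ : ∀ {m n} a (A : Matrix m m) (X : Matrix m n) → (a ⊙ I ⊖ A) ⊗ X ≋ a ⊙ X ⊖ A ⊗ X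
  [⊙I⊖]⊗ a A X i j = trans (⊙⊖-⊗ a I A X i j) (+-congʳ (*-congˡ (⊗-identityˡ X i j)))

  tr-⊙⊖ : ∀ {n} a (A B : Matrix n n) → tr (a ⊙ A ⊖ B) ≈ a * tr A - tr B
  tr-⊙⊖ a A B = trans (sum-minus (λ i → a * A i i) (λ i → B i i)) (+-congʳ (≈-sym (*-distribˡ-sum a (λ i → A i i))))

  ∙-transpose : ∀ {m n} (A : Matrix m n) x y → x ∙ (A ᵀ ⊛ y) ≈ (A ⊛ x) ∙ y
  ∙-transpose {m} {n} A x y = begin
    ∑[ i < n ] (x i * ∑[ k < m ] (A k i * y k))       ≈⟨ sum-cong-≋ {n} (λ i → *-distribˡ-sum (x i) (λ k → A k i * y k)) ⟩
    ∑[ i < n ] ∑[ k < m ] (x i * (A k i * y k))       ≈⟨ ∑-comm (λ i k → x i * (A k i * y k)) ⟩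
    ∑[ k < m ] ∑[ i < n ] (x i * (A k i * y k))       ≈⟨ sum-cong-≋ {m} (λ k → sum-cong-≋ {n} (λ i → solve 3 (λ x a y → x :* (a :* y) := a :* x :* y) refl (x i) (A k i) (y k))) ⟩
    ∑[ k < m ] ∑[ i < n ] (A k i * x i * y k)         ≈⟨ sum-cong-≋ {m} (λ k → *-distribʳ-sum (y k) (λ i → A k i * x i)) ⟨
    ∑[ k < m ] ((A ⊛ x) k * y k)                      ∎

  tr-⊗-comm : ∀ {m n} (A : Matrix m n) (B : Matrix n m) → tr (A ⊗ B) ≈ tr (B ⊗ A)
  tr-⊗-comm A B = trans (∑-comm (λ i k → A i k * B k i)) (sum-cong-≋ (λ k → sum-cong-≋ (λ i → *-comm (A i k) (B k i))))

  tr-I : ∀ n → tr (I {n}) ≈ fromℕ n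
  tr-I n = begin
    tr (I {n})        ≈⟨ sum-cong-≋ {n} (λ i → I-≡ {i = i} ≡.refl) ⟩
    ∑[ i < n ] 1#     ≈⟨ sum-const n 1# ⟩
    fromℕ n * 1#      ≈⟨ *-identityʳ (fromℕ n) ⟩
    fromℕ n           ∎

  Symmetric : ∀ {n} → Matrix n n → Set ℓ₁
  Symmetric A = A ᵀ ≋ A

  symmetric-leftInverse : ∀ {n} {A B : Matrix n n} → Symmetric A → Symmetric B → A ⊗ B ≋ I → B ⊗ A ≋ I
  symmetric-leftInverse {A = A} {B} Aᵀ≋A Bᵀ≋B AB≋I i j = begin
    (B ⊗ A) i j        ≈⟨ ⊗-cong Bᵀ≋B Aᵀ≋A i j ⟨
    (B ᵀ ⊗ A ᵀ) i j    ≈⟨ ⊗-ᵀ A B i j ⟨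
    (A ⊗ B) j i        ≈⟨ AB≋I j i ⟩
    I j i              ≈⟨ I-sym j i ⟩
    I i j              ∎

  -- As A is symmetric, Bᵀ A is the transpose of A B, hence I, and Bᵀ = Bᵀ (A B) = (Bᵀ A) B = B.
  -- Together with the previous lemma, a right inverse of a symmetric matrix is two-sided.
  symmetric-rightInverse : ∀ {n} {A B : Matrix n n} → Symmetric A → A ⊗ B ≋ I → Symmetric B
  symmetric-rightInverse {A = A} {B} Aᵀ≋A AB≋I i j = begin
    B j i                      ≈⟨ ⊗-identityʳ (B ᵀ) i j ⟨
    (B ᵀ ⊗ I) i j              ≈⟨ ⊗-congˡ (B ᵀ) AB≋I i j ⟨
    (B ᵀ ⊗ (A ⊗ B)) i j        ≈⟨ ⊗-assoc (B ᵀ) A B i j ⟨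
    (B ᵀ ⊗ A ⊗ B) i j          ≈⟨ ⊗-congʳ B BᵀA≋I i j ⟩
    (I ⊗ B) i j                ≈⟨ ⊗-identityˡ B i j ⟩
    B i j                      ∎
    where
    BᵀA≋I : B ᵀ ⊗ A ≋ I
    BᵀA≋I k l = begin
      (B ᵀ ⊗ A) k l      ≈⟨ ⊗-congˡ (B ᵀ) Aᵀ≋A k l ⟨
      (B ᵀ ⊗ A ᵀ) k l    ≈⟨ ⊗-ᵀ A B k l ⟨
      (A ⊗ B) l k        ≈⟨ AB≋I l k ⟩
      I l k              ≈⟨ I-sym l k ⟩
      I k l              ∎

  -- Positive definite matrices and linear systems.

  -- A nonzero vector is one with a named entry apart from zero: strict positivity is positive
  -- information and needs a positive witness.
  PositiveDefinite : ∀ {n} → Matrix n n → Set (c ⊔ ℓ₂ ⊔ ℓ₃)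
  PositiveDefinite {n} A = ∀ (x : Column n) → (∃[ i ] x i # 0#) → 0# < x ∙ (A ⊛ x)

  trailing : ∀ {n} → Matrix (suc n) (suc n) → Matrix n n
  trailing A i j = A (suc i) (suc j)

  infixr 5 _∷ᶜ_

  _∷ᶜ_ : ∀ {n} → Carrier → Column n → Column (suc n)
  (a ∷ᶜ x) zero    = a
  (a ∷ᶜ x) (suc i) = x i

  trailing-positiveDefinite : ∀ {n} (A : Matrix (suc n) (suc n)) → PositiveDefinite A → PositiveDefinite (trailing A)
  trailing-positiveDefinite A pd x (i , xᵢ#0) = <-respʳ-≈ form (pd (0# ∷ᶜ x) (suc i , xᵢ#0))
    where
    form : (0# ∷ᶜ x) ∙ (A ⊛ (0# ∷ᶜ x)) ≈ x ∙ (trailing A ⊛ x)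
    form = trans (+-cong (zeroˡ _) (sum-cong-≋ (λ i → *-congˡ {x i} (trans (+-congʳ (zeroʳ (A (suc i) zero))) (+-identityˡ ((trailing A ⊛ x) i)))))) (+-identityˡ (x ∙ (trailing A ⊛ x)))

  -- Bordering: with D the trailing block and D w = - A₁₀, the vector x = (1 , w)
  -- satisfies A x = (s , 0), where s = xᵀ A x is positive.  A solution for the
  -- trailing block is corrected in its first entry by a multiple of x.
  positiveDefinite⇒solvable : ∀ {n} (A : Matrix n n) → PositiveDefinite A →
                              ∀ (v : Column n) → Σ[ y ∈ Column n ] (∀ i → (A ⊛ y) i ≈ v i)
  positiveDefinite⇒solvable {ℕ.zero} A pd v = v , λ ()
  positiveDefinite⇒solvable {suc n}  A pd v = (λ i → (0# ∷ᶜ u) i + r * x i) , solution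
    where
    solveᴰ : ∀ (v : Column n) → Σ[ y ∈ Column n ] (∀ i → (trailing A ⊛ y) i ≈ v i)
    solveᴰ = positiveDefinite⇒solvable (trailing A) (trailing-positiveDefinite A pd)

    w u : Column n
    w = proj₁ (solveᴰ (λ i → - A (suc i) zero))
    u = proj₁ (solveᴰ (v ∘ suc))

    x : Column (suc n)
    x = 1# ∷ᶜ w

    s r : Carrier
    s = (A ⊛ x) zero

    Ax≈0 : ∀ i → (A ⊛ x) (suc i) ≈ 0#
    Ax≈0 i = trans (+-cong (*-identityʳ _) (proj₂ (solveᴰ (λ i → - A (suc i) zero)) i)) (-‿inverseʳ _)

    0<s : 0# < s
    0<s = <-respʳ-≈ (trans (+-cong (*-identityˡ s) (sum-zero _ (λ i → trans (*-congˡ (Ax≈0 i)) (zeroʳ _)))) (+-identityʳ s))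
      (pd x (zero , 1#0))

    s#0 : s # 0#
    s#0 = >⇒#0 0<s

    t : Carrier
    t = (A ⊛ (0# ∷ᶜ u)) zero

    r = (v zero - t) * inverse s#0

    linear : ∀ i → (A ⊛ (λ k → (0# ∷ᶜ u) k + r * x k)) i ≈ (A ⊛ (0# ∷ᶜ u)) i + r * (A ⊛ x) i
    linear i = begin
      ∑[ k < suc n ] (A i k * ((0# ∷ᶜ u) k + r * x k))           ≈⟨ sum-cong-≋ {suc n} (λ k → solve 4 (λ a y r x → a :* (y :+ r :* x) := a :* y :+ r :* (a :* x)) refl (A i k) ((0# ∷ᶜ u) k) r (x k)) ⟩
      ∑[ k < suc n ] (A i k * (0# ∷ᶜ u) k + r * (A i k * x k))   ≈⟨ ∑-distrib-+ (λ k → A i k * (0# ∷ᶜ u) k) (λ k → r * (A i k * x k)) ⟩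
      (A ⊛ (0# ∷ᶜ u)) i + ∑[ k < suc n ] (r * (A i k * x k))     ≈⟨ +-congˡ (*-distribˡ-sum r (λ k → A i k * x k)) ⟨
      (A ⊛ (0# ∷ᶜ u)) i + r * (A ⊛ x) i                          ∎

    solution : ∀ i → (A ⊛ (λ k → (0# ∷ᶜ u) k + r * x k)) i ≈ v i
    solution zero = begin
      (A ⊛ (λ k → (0# ∷ᶜ u) k + r * x k)) zero   ≈⟨ linear zero ⟩
      t + (v zero - t) * inverse s#0 * s         ≈⟨ solve 4 (λ t v i s → t :+ (v :- t) :* i :* s := t :+ (v :- t) :* (s :* i)) refl t (v zero) (inverse s#0) s ⟩
      t + (v zero - t) * (s * inverse s#0)       ≈⟨ +-congˡ (*-congˡ (*-inverseʳ s#0)) ⟩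
      t + (v zero - t) * 1#                      ≈⟨ solve 2 (λ t v → t :+ (v :- t) :* con (+ 1) := v) refl t (v zero) ⟩
      v zero                                     ∎
    solution (suc i) = begin
      (A ⊛ (λ k → (0# ∷ᶜ u) k + r * x k)) (suc i)     ≈⟨ linear (suc i) ⟩
      (A ⊛ (0# ∷ᶜ u)) (suc i) + r * (A ⊛ x) (suc i)   ≈⟨ +-cong (trans (+-cong (zeroʳ _) (proj₂ (solveᴰ (v ∘ suc)) i)) (+-identityˡ _)) (trans (*-congˡ (Ax≈0 i)) (zeroʳ r)) ⟩
      v (suc i) + 0#                                  ≈⟨ +-identityʳ _ ⟩
      v (suc i)                                       ∎

  positiveDefinite⇒rightInverse : ∀ {n} (A : Matrix n n) → PositiveDefinite A → Σ[ C ∈ Matrix n n ] A ⊗ C ≋ I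
  positiveDefinite⇒rightInverse A pd =
    (λ i j → proj₁ (column j) i) , λ i j → proj₂ (column j) i
    where
    column : ∀ j → Σ[ y ∈ Column _ ] (∀ i → (A ⊛ y) i ≈ I i j)
    column j = positiveDefinite⇒solvable A pd (λ i → I i j)

  -- Determinants

  minor : ∀ {n} → Fin (suc n) → Matrix (suc n) (suc n) → Matrix n n
  minor j A i k = A (suc i) (punchIn j k)

  sign : ∀ {n} → Fin n → Carrier
  sign j = (- 1#) ^ toℕ j

  expansionTerm : ∀ {n} → Matrix (suc n) (suc n) → Fin (suc n) → Carrier
  expansionTerm A j = sign j * A zero j * det (minor j A)

  det-cong : ∀ {n} (A B : Matrix n n) → A ≋ B → det A ≈ det B
  det-cong {ℕ.zero} A B A≋B = refl
  det-cong {suc n}  A B A≋B = sum-cong-≋ {suc n} (λ j →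
    *-cong (*-congˡ {sign j} (A≋B zero j)) (det-cong (minor j A) (minor j B) (λ i k → A≋B (suc i) (punchIn j k))))

  AgreeOff : ∀ {m n} → Fin n → Matrix m n → Matrix m n → Set ℓ₁
  AgreeOff i A B = ∀ r k → k ≢ i → A r k ≈ B r k

  -- Expand along the first row. At j = i the minors omit column i and agree, and the entry carries
  -- the linear combination; at any other j the entries agree, and the minor is linear in the column
  -- that i becomes after deleting j.
  det-linear : ∀ {n} i (A B C : Matrix n n) a b → AgreeOff i C A → AgreeOff i C B →
               (∀ r → C r i ≈ a * A r i + b * B r i) → det C ≈ a * det A + b * det B
  det-linear {suc n} i A B C a b CA CB Cᵢ = begin
    sum (expansionTerm C)                                                 ≈⟨ sum-cong-≋ {suc n} term ⟩
    ∑[ j < suc n ] (a * expansionTerm A j + b * expansionTerm B j)        ≈⟨ ∑-distrib-+ (λ j → a * expansionTerm A j) (λ j → b * expansionTerm B j) ⟩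
    ∑[ j < suc n ] (a * expansionTerm A j) + ∑[ j < suc n ] (b * expansionTerm B j)  ≈⟨ +-cong (*-distribˡ-sum a (expansionTerm A)) (*-distribˡ-sum b (expansionTerm B)) ⟨
    a * det A + b * det B                                                 ∎
    where
    term : ∀ j → expansionTerm C j ≈ a * expansionTerm A j + b * expansionTerm B j
    term j with j ≟ i
    ... | yes ≡.refl = begin
      sign j * C zero j * det (minor j C)                     ≈⟨ *-congʳ (*-congˡ (Cᵢ zero)) ⟩
      sign j * (a * A zero j + b * B zero j) * det (minor j C)
        ≈⟨ solve 6 (λ s a x b y m → s :* (a :* x :+ b :* y) :* m := a :* (s :* x :* m) :+ b :* (s :* y :* m)) refl (sign j) a (A zero j) b (B zero j) (det (minor j C)) ⟩
      a * (sign j * A zero j * det (minor j C)) + b * (sign j * B zero j * det (minor j C))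
        ≈⟨ +-cong (*-congˡ (*-congˡ (det-cong _ _ (λ r k → CA (suc r) _ (punchInᵢ≢i j k))))) (*-congˡ (*-congˡ (det-cong _ _ (λ r k → CB (suc r) _ (punchInᵢ≢i j k))))) ⟩
      a * expansionTerm A j + b * expansionTerm B j           ∎
    ... | no j≢i = begin
      sign j * C zero j * det (minor j C)                     ≈⟨ *-congˡ minorLinear ⟩
      sign j * C zero j * (a * det (minor j A) + b * det (minor j B))
        ≈⟨ solve 6 (λ s x a m b m′ → s :* x :* (a :* m :+ b :* m′) := a :* (s :* x :* m) :+ b :* (s :* x :* m′)) refl (sign j) (C zero j) a (det (minor j A)) b (det (minor j B)) ⟩
      a * (sign j * C zero j * det (minor j A)) + b * (sign j * C zero j * det (minor j B))
        ≈⟨ +-cong (*-congˡ (*-congʳ (*-congˡ (CA zero j j≢i)))) (*-congˡ (*-congʳ (*-congˡ (CB zero j j≢i)))) ⟩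
      a * expansionTerm A j + b * expansionTerm B j           ∎
      where
      i′ : Fin n
      i′ = punchOut j≢i

      j[i′]≡i : punchIn j i′ ≡ i
      j[i′]≡i = punchIn-punchOut j≢i

      off : ∀ k → k ≢ i′ → punchIn j k ≢ i
      off k k≢i′ eq = k≢i′ (punchIn-injective j k i′ (≡.trans eq (≡.sym j[i′]≡i)))

      minorLinear : det (minor j C) ≈ a * det (minor j A) + b * det (minor j B)
      minorLinear = det-linear i′ (minor j A) (minor j B) (minor j C) a b
        (λ r k k≢i′ → CA (suc r) _ (off k k≢i′)) (λ r k k≢i′ → CB (suc r) _ (off k k≢i′))
        (λ r → ≡.subst (λ k → C (suc r) k ≈ a * A (suc r) k + b * B (suc r) k) (≡.sym j[i′]≡i) (Cᵢ (suc r)))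

  -- The case of `det-linear` with both coefficients zero, where all three matrices are A.
  det-zeroColumn : ∀ {n} i (A : Matrix n n) → (∀ r → A r i ≈ 0#) → det A ≈ 0#
  det-zeroColumn i A Aᵢ≈0 = trans
    (det-linear i A A A 0# 0# (λ _ _ _ → refl) (λ _ _ _ → refl)
      (λ r → trans (Aᵢ≈0 r) (solve 1 (λ x → con (+ 0) := con (+ 0) :* x :+ con (+ 0) :* x) refl (A r i))))
    (solve 1 (λ x → con (+ 0) :* x :+ con (+ 0) :* x := con (+ 0)) refl (det A))

  infixl 8 _[_≔_]

  _[_≔_] : ∀ {m n} → Matrix m n → Fin n → Column m → Matrix m n
  (A [ i ≔ v ]) r = updateAt (A r) i (λ _ → v r)

  ≔-updates : ∀ {m n} (A : Matrix m n) i v r → (A [ i ≔ v ]) r i ≡ v r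
  ≔-updates A i v r = updateAt-updates i (A r)

  ≔-minimal : ∀ {m n} (A : Matrix m n) i v r {k} → k ≢ i → (A [ i ≔ v ]) r k ≡ A r k
  ≔-minimal A i v r {k} k≢i = updateAt-minimal k i (A r) k≢i

  ≔-cong : ∀ {m n} (A : Matrix m n) i (u v : Column m) → (∀ r → u r ≈ v r) → A [ i ≔ u ] ≋ A [ i ≔ v ]
  ≔-cong A i u v u≈v r k with k ≟ i
  ... | yes ≡.refl = trans (reflexive (≔-updates A i u r)) (trans (u≈v r) (reflexive (≡.sym (≔-updates A i v r))))
  ... | no k≢i     = reflexive (≡.trans (≔-minimal A i u r k≢i) (≡.sym (≔-minimal A i v r k≢i)))

  det-≔-linear : ∀ {n} (A : Matrix n n) i a b (u v : Column n) →
                 det (A [ i ≔ (λ r → a * u r + b * v r) ]) ≈ a * det (A [ i ≔ u ]) + b * det (A [ i ≔ v ])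
  det-≔-linear A i a b u v = det-linear i (A [ i ≔ u ]) (A [ i ≔ v ]) (A [ i ≔ w ]) a b (off w u) (off w v)
    (λ r → reflexive (≡.trans (≔-updates A i w r)
      (≡.sym (≡.cong₂ (λ x y → a * x + b * y) (≔-updates A i u r) (≔-updates A i v r)))))
    where
    w : Column _
    w r = a * u r + b * v r

    off : ∀ v w → AgreeOff i (A [ i ≔ v ]) (A [ i ≔ w ])
    off v w r k k≢i = reflexive (≡.trans (≔-minimal A i v r k≢i) (≡.sym (≔-minimal A i w r k≢i)))

  det-≔-sum : ∀ {n} m (A : Matrix n n) i (a : Fin m → Carrier) (u : Fin m → Column n) →
              det (A [ i ≔ (λ r → ∑[ k < m ] (a k * u k r)) ]) ≈ ∑[ k < m ] (a k * det (A [ i ≔ u k ]))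
  det-≔-sum ℕ.zero  A i a u = det-zeroColumn i (A [ i ≔ _ ]) (λ r → reflexive (≔-updates A i _ r))
  det-≔-sum (suc m) A i a u = begin
    det (A [ i ≔ (λ r → a zero * u zero r + rest r) ])                     ≈⟨ det-cong _ _ (≔-cong A i _ _ (λ r → +-congˡ (≈-sym (*-identityˡ (rest r))))) ⟩
    det (A [ i ≔ (λ r → a zero * u zero r + 1# * rest r) ])                ≈⟨ det-≔-linear A i (a zero) 1# (u zero) rest ⟩
    a zero * det (A [ i ≔ u zero ]) + 1# * det (A [ i ≔ rest ])            ≈⟨ +-congˡ (trans (*-identityˡ _) (det-≔-sum m A i (a ∘ suc) (u ∘ suc))) ⟩
    a zero * det (A [ i ≔ u zero ]) + ∑[ k < m ] (a (suc k) * det (A [ i ≔ u (suc k) ]))  ∎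
    where
    rest : Column _
    rest r = ∑[ k < m ] (a (suc k) * u (suc k) r)

  -- The determinant as an alternating function of the columns.

  sum-adjacent : ∀ {n} (f : Fin (suc n) → Carrier) (i : Fin n) →
                 (∀ j → j ≢ inject₁ i → j ≢ suc i → f j ≈ 0#) → f (inject₁ i) + f (suc i) ≈ 0# → sum f ≈ 0#
  sum-adjacent f zero f≈0 pair = begin
    f zero + (f (suc zero) + sum (λ k → f (suc (suc k))))  ≈⟨ +-assoc _ _ _ ⟨
    (f zero + f (suc zero)) + sum (λ k → f (suc (suc k)))  ≈⟨ +-cong pair (sum-zero (λ k → f (suc (suc k))) (λ k → f≈0 (suc (suc k)) (λ ()) (λ ()))) ⟩
    0# + 0#                                                ≈⟨ +-identityˡ 0# ⟩
    0#                                                     ∎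
  sum-adjacent f (suc i) f≈0 pair = begin
    f zero + sum (f ∘ suc)   ≈⟨ +-cong (f≈0 zero (λ ()) (λ ())) (sum-adjacent (f ∘ suc) i (λ j j≢i j≢1+i → f≈0 (suc j) (j≢i ∘ suc-injective) (j≢1+i ∘ suc-injective)) pair) ⟩
    0# + 0#                  ≈⟨ +-identityˡ 0# ⟩
    0#                       ∎

  -- In the first-row expansion, a minor omitting some other column still has two equal neighbours
  -- and vanishes by induction. The two remaining terms have equal entries, equal minors and
  -- opposite signs.
  det-adjacentColumns : ∀ {n} (i : Fin n) (A : Matrix (suc n) (suc n)) →
                        (∀ r → A r (inject₁ i) ≈ A r (suc i)) → det A ≈ 0#
  det-adjacentColumns {suc n} i A Aᵢ≈Aᵢ₊₁ = sum-adjacent (expansionTerm A) i others pair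
    where
    others : ∀ j → j ≢ inject₁ i → j ≢ suc i → expansionTerm A j ≈ 0#
    others j j≢i j≢1+i with punchIn-off-adjacent i j j≢i j≢1+i
    ... | i′ , eq , eq′ = trans (*-congˡ (det-adjacentColumns i′ (minor j A) (λ r → begin
      A (suc r) (punchIn j (inject₁ i′))  ≡⟨ ≡.cong (A (suc r)) eq ⟩
      A (suc r) (inject₁ i)               ≈⟨ Aᵢ≈Aᵢ₊₁ (suc r) ⟩
      A (suc r) (suc i)                   ≡⟨ ≡.cong (A (suc r)) eq′ ⟨
      A (suc r) (punchIn j (suc i′))      ∎))) (zeroʳ _)

    minors : minor (inject₁ i) A ≋ minor (suc i) A
    minors r k with punchIn-adjacent i k
    ... | inj₁ eq         = reflexive (≡.cong (A (suc r)) eq)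
    ... | inj₂ (eq , eq′) = begin
      A (suc r) (punchIn (inject₁ i) k)   ≡⟨ ≡.cong (A (suc r)) eq ⟩
      A (suc r) (suc i)                   ≈⟨ Aᵢ≈Aᵢ₊₁ (suc r) ⟨
      A (suc r) (inject₁ i)               ≡⟨ ≡.cong (A (suc r)) eq′ ⟨
      A (suc r) (punchIn (suc i) k)       ∎

    pair : expansionTerm A (inject₁ i) + expansionTerm A (suc i) ≈ 0#
    pair = begin
      sign (inject₁ i) * A zero (inject₁ i) * det (minor (inject₁ i) A) + expansionTerm A (suc i)
        ≈⟨ +-congʳ (*-cong (*-cong (reflexive (≡.cong ((- 1#) ^_) (toℕ-inject₁ i))) (Aᵢ≈Aᵢ₊₁ zero)) (det-cong (minor (inject₁ i) A) (minor (suc i) A) minors)) ⟩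
      sign i * A zero (suc i) * det (minor (suc i) A) + (- 1# * sign i) * A zero (suc i) * det (minor (suc i) A)
        ≈⟨ solve 3 (λ s a d → s :* a :* d :+ (:- con (+ 1) :* s) :* a :* d := con (+ 0)) refl (sign i) (A zero (suc i)) (det (minor (suc i) A)) ⟩
      0#  ∎

  module _ {n : ℕ} (A : Matrix (suc n) (suc n)) (i : Fin n) where

    private
      P : Column (suc n) → Column (suc n) → Matrix (suc n) (suc n)
      P u v = A [ inject₁ i ≔ u ] [ suc i ≔ v ]

      P-first : ∀ u v r → P u v r (inject₁ i) ≡ u r
      P-first u v r = ≡.trans (≔-minimal (A [ inject₁ i ≔ u ]) (suc i) v r (inject₁≢suc i)) (≔-updates A (inject₁ i) u r)

      P-second : ∀ u v r → P u v r (suc i) ≡ v r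
      P-second u v r = ≔-updates (A [ inject₁ i ≔ u ]) (suc i) v r

      P-other : ∀ u v r {k} → k ≢ inject₁ i → k ≢ suc i → P u v r k ≡ A r k
      P-other u v r k≢i k≢1+i = ≡.trans (≔-minimal (A [ inject₁ i ≔ u ]) (suc i) v r k≢1+i) (≔-minimal A (inject₁ i) u r k≢i)

      P-agreeFirst : ∀ u u′ v → AgreeOff (inject₁ i) (P u v) (P u′ v)
      P-agreeFirst u u′ v r k k≢i with k ≟ suc i
      ... | yes ≡.refl = reflexive (≡.trans (P-second u v r) (≡.sym (P-second u′ v r)))
      ... | no k≢1+i   = reflexive (≡.trans (P-other u v r k≢i k≢1+i) (≡.sym (P-other u′ v r k≢i k≢1+i)))

      P-alternating : ∀ u → det (P u u) ≈ 0#
      P-alternating u = det-adjacentColumns i (P u u) (λ r → reflexive (≡.trans (P-first u u r) (≡.sym (P-second u u r))))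

      P-additiveFirst : ∀ u u′ v → det (P (λ r → 1# * u r + 1# * u′ r) v) ≈ 1# * det (P u v) + 1# * det (P u′ v)
      P-additiveFirst u u′ v = det-linear (inject₁ i) (P u v) (P u′ v) (P w v) 1# 1#
        (P-agreeFirst w u v) (P-agreeFirst w u′ v)
        (λ r → reflexive (≡.trans (P-first w v r)
          (≡.sym (≡.cong₂ (λ x y → 1# * x + 1# * y) (P-first u v r) (P-first u′ v r)))))
        where
        w : Column (suc n)
        w r = 1# * u r + 1# * u′ r

      -- Polarisation: expanding `det (P w w)` for w = u + v leaves the two mixed terms, as the two
      -- repeated ones vanish. The factors `1#` only fit the expression to the shape of
      -- `det-linear`.
      P-antisymmetric : ∀ u v → det (P u v) ≈ - det (P v u)
      P-antisymmetric u v = begin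
        det (P u v)                         ≈⟨ solve 2 (λ x y → x := (con (+ 1) :* (con (+ 1) :* con (+ 0) :+ con (+ 1) :* x) :+ con (+ 1) :* (con (+ 1) :* y :+ con (+ 1) :* con (+ 0))) :- y) refl (det (P u v)) (det (P v u)) ⟩
        (1# * (1# * 0# + 1# * det (P u v)) + 1# * (1# * det (P v u) + 1# * 0#)) - det (P v u)
          ≈⟨ +-congʳ (+-cong (*-congˡ (+-congʳ (*-congˡ (P-alternating u)))) (*-congˡ (+-congˡ (*-congˡ (P-alternating v))))) ⟨
        (1# * (1# * det (P u u) + 1# * det (P u v)) + 1# * (1# * det (P v u) + 1# * det (P v v))) - det (P v u)
          ≈⟨ +-congʳ (+-cong (*-congˡ (det-≔-linear (A [ inject₁ i ≔ u ]) (suc i) 1# 1# u v)) (*-congˡ (det-≔-linear (A [ inject₁ i ≔ v ]) (suc i) 1# 1# u v))) ⟨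
        (1# * det (P u w) + 1# * det (P v w)) - det (P v u)  ≈⟨ +-congʳ (P-additiveFirst u v w) ⟨
        det (P w w) - det (P v u)           ≈⟨ +-congʳ (P-alternating w) ⟩
        0# - det (P v u)                    ≈⟨ +-identityˡ _ ⟩
        - det (P v u)                       ∎
        where
        w : Column (suc n)
        w r = 1# * u r + 1# * v r

    swapAdjacent : Matrix (suc n) (suc n)
    swapAdjacent = P (λ r → A r (suc i)) (λ r → A r (inject₁ i))

    swapAdjacent-first : ∀ r → swapAdjacent r (inject₁ i) ≡ A r (suc i)
    swapAdjacent-first = P-first (λ r → A r (suc i)) (λ r → A r (inject₁ i))

    swapAdjacent-other : ∀ r {k} → k ≢ inject₁ i → k ≢ suc i → swapAdjacent r k ≡ A r k
    swapAdjacent-other = P-other (λ r → A r (suc i)) (λ r → A r (inject₁ i))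

    det-swapAdjacent : det A ≈ - det swapAdjacent
    det-swapAdjacent = trans (det-cong A (P first second) unchanged) (P-antisymmetric first second)
      where
      first second : Column (suc n)
      first  r = A r (inject₁ i)
      second r = A r (suc i)

      unchanged : A ≋ P first second
      unchanged r k with k ≟ suc i
      ... | yes ≡.refl = reflexive (≡.sym (P-second first second r))
      ... | no k≢1+i with k ≟ inject₁ i
      ...   | yes ≡.refl = reflexive (≡.sym (P-first first second r))
      ...   | no k≢i     = reflexive (≡.sym (P-other first second r k≢i k≢1+i))

  -- Here d counts the columns strictly between a and b. Exchanging b with its left neighbour lowers
  -- d by one at the cost of a sign, until the equal columns are adjacent.
  det-equalColumns-< : ∀ {n} d (A : Matrix n n) (a b : Fin n) → toℕ b ≡ suc (d ℕ.+ toℕ a) →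
                       (∀ r → A r a ≈ A r b) → det A ≈ 0#
  det-equalColumns-< ℕ.zero A a (suc b) eq Aₐ≈A_b =
    det-adjacentColumns b A (λ r → ≡.subst (λ k → A r k ≈ A r (suc b)) a≡b (Aₐ≈A_b r))
    where
    a≡b : a ≡ inject₁ b
    a≡b = toℕ-injective (≡.trans (≡.sym (ℕ.suc-injective eq)) (≡.sym (toℕ-inject₁ b)))
  det-equalColumns-< (suc d) A a (suc b) eq Aₐ≈A_b = begin
    det A                       ≈⟨ det-swapAdjacent A b ⟩
    - det (swapAdjacent A b)    ≈⟨ -‿cong (det-equalColumns-< d (swapAdjacent A b) a (inject₁ b) inject₁b≡ equal) ⟩
    - 0#                        ≈⟨ -0#≈0# ⟩
    0#                          ∎
    where
    inject₁b≡ : toℕ (inject₁ b) ≡ suc (d ℕ.+ toℕ a)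
    inject₁b≡ = ≡.trans (toℕ-inject₁ b) (ℕ.suc-injective eq)

    a≢inject₁b : a ≢ inject₁ b
    a≢inject₁b a≡b = ℕ.m≢1+n+m (toℕ a) (≡.trans (≡.cong toℕ a≡b) inject₁b≡)

    a≢suc-b : a ≢ suc b
    a≢suc-b a≡b = ℕ.m≢1+n+m (toℕ a) (≡.trans (≡.cong toℕ a≡b) eq)

    equal : ∀ r → swapAdjacent A b r a ≈ swapAdjacent A b r (inject₁ b)
    equal r = begin
      swapAdjacent A b r a            ≡⟨ swapAdjacent-other A b r a≢inject₁b a≢suc-b ⟩
      A r a                           ≈⟨ Aₐ≈A_b r ⟩
      A r (suc b)                     ≡⟨ swapAdjacent-first A b r ⟨
      swapAdjacent A b r (inject₁ b)  ∎

  det-equalColumns : ∀ {n} (A : Matrix n n) (a b : Fin n) → a ≢ b → (∀ r → A r a ≈ A r b) → det A ≈ 0#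
  det-equalColumns A a b a≢b Aₐ≈A_b with <-cmp a b
  ... | tri≈ _ a≡b _ = contradiction a≡b a≢b
  ... | tri< a<b _ _ with ℕ.m≤n⇒∃[o]m+o≡n a<b
  ...   | d , eq = det-equalColumns-< d A a b (≡.trans (≡.sym eq) (≡.cong suc (ℕ.+-comm (toℕ a) d))) Aₐ≈A_b
  det-equalColumns A a b a≢b Aₐ≈A_b | tri> _ _ b<a with ℕ.m≤n⇒∃[o]m+o≡n b<a
  ...   | d , eq = det-equalColumns-< d A b a (≡.trans (≡.sym eq) (≡.cong suc (ℕ.+-comm (toℕ b) d))) (λ r → ≈-sym (Aₐ≈A_b r))

  -- Since v is the combination of the columns of A with coefficients x, linearity in column i gives
  -- one determinant per column of A. Each of them repeats a column, except the i-th, which is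
  -- `det A`.
  cramer : ∀ {n} (A : Matrix n n) (x v : Column n) → (∀ r → (A ⊛ x) r ≈ v r) → ∀ i → det (A [ i ≔ v ]) ≈ x i * det A
  cramer {n} A x v Ax≈v i = begin
    det (A [ i ≔ v ])                                     ≈⟨ det-cong _ _ (≔-cong A i v _ (λ r → trans (≈-sym (Ax≈v r)) (sum-cong-≋ (λ k → *-comm (A r k) (x k))))) ⟩
    det (A [ i ≔ (λ r → ∑[ k < n ] (x k * A r k)) ])      ≈⟨ det-≔-sum n A i x (λ k r → A r k) ⟩
    ∑[ k < n ] (x k * det (A [ i ≔ (λ r → A r k) ]))      ≈⟨ sum-single (λ k → x k * det (A [ i ≔ (λ r → A r k) ])) i others ⟩
    x i * det (A [ i ≔ (λ r → A r i) ])                   ≈⟨ *-congˡ (det-cong (A [ i ≔ (λ r → A r i) ]) A unchanged) ⟩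
    x i * det A                                           ∎
    where
    unchanged : A [ i ≔ (λ r → A r i) ] ≋ A
    unchanged r k with k ≟ i
    ... | yes ≡.refl = reflexive (≔-updates A i (λ r → A r i) r)
    ... | no k≢i     = reflexive (≔-minimal A i (λ r → A r i) r k≢i)

    others : ∀ k → k ≢ i → x k * det (A [ i ≔ (λ r → A r k) ]) ≈ 0#
    others k k≢i = trans (*-congˡ (det-equalColumns (A [ i ≔ (λ r → A r k) ]) k i k≢i
      (λ r → reflexive (≡.trans (≔-minimal A i (λ r → A r k) r k≢i) (≡.sym (≔-updates A i (λ r → A r k) r)))))) (zeroʳ (x k))

  -- For the solution y of A y = e₀, Cramer's rule gives y₀ det A as the determinant of A with first
  -- column e₀, which is that of the trailing block. By induction this product is apart from zero,
  -- hence so is its factor `det A`. It is applied to n I - Q, where it makes every n - θ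
  -- invertible.
  positiveDefinite⇒det#0 : ∀ {n} (A : Matrix n n) → PositiveDefinite A → det A # 0#
  positiveDefinite⇒det#0 {ℕ.zero} A pd = 1#0
  positiveDefinite⇒det#0 {suc n}  A pd = *-#0ʳ (#-congʳ
    (≈-sym (trans (≈-sym (cramer A y e₀ Ay≈e₀ zero)) expand))
    (positiveDefinite⇒det#0 (trailing A) (trailing-positiveDefinite A pd)))
    where
    e₀ y : Column (suc n)
    e₀ i = I i zero
    y = proj₁ (positiveDefinite⇒solvable A pd e₀)

    Ay≈e₀ : ∀ i → (A ⊛ y) i ≈ e₀ i
    Ay≈e₀ = proj₂ (positiveDefinite⇒solvable A pd e₀)

    -- Deleting the first row and a later column keeps column zero, and e₀ has only zeros below its
    -- first entry.
    others : ∀ {n} (A : Matrix (suc n) (suc n)) (j : Fin n) →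
             det (minor (suc j) (A [ zero ≔ (λ i → I i zero) ])) ≈ 0#
    others {suc n} A j = det-zeroColumn zero (minor (suc j) (A [ zero ≔ (λ i → I i zero) ])) (λ r → refl)

    expand : det (A [ zero ≔ e₀ ]) ≈ det (trailing A)
    expand = begin
      1# * 1# * det (trailing A) + sum (λ j → expansionTerm (A [ zero ≔ e₀ ]) (suc j))
        ≈⟨ +-cong (solve 1 (λ d → con (+ 1) :* con (+ 1) :* d := d) refl (det (trailing A)))
                  (sum-zero (λ j → expansionTerm (A [ zero ≔ e₀ ]) (suc j)) (λ j → trans (*-congˡ {sign (suc j) * A zero (suc j)} (others A j)) (zeroʳ _))) ⟩
      det (trailing A) + 0#  ≈⟨ +-identityʳ _ ⟩
      det (trailing A)       ∎

  -- Polynomial functions and their linear parts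

  eval : List Carrier → Carrier → Carrier
  eval []       t = 0#
  eval (c ∷ cs) t = c + t * eval cs t

  infixl 6 _+ᴾ_
  infixl 7 _*ᴾ_ _∗ᴾ_

  _∗ᴾ_ : Carrier → List Carrier → List Carrier
  a ∗ᴾ cs = List.map (a *_) cs

  _+ᴾ_ : List Carrier → List Carrier → List Carrier
  []       +ᴾ ds       = ds
  (c ∷ cs) +ᴾ []       = c ∷ cs
  (c ∷ cs) +ᴾ (d ∷ ds) = c + d ∷ cs +ᴾ ds

  _*ᴾ_ : List Carrier → List Carrier → List Carrier
  []       *ᴾ ds = []
  (c ∷ cs) *ᴾ ds = c ∗ᴾ ds +ᴾ (0# ∷ cs *ᴾ ds)

  eval-∗ : ∀ a cs t → eval (a ∗ᴾ cs) t ≈ a * eval cs t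
  eval-∗ a []       t = ≈-sym (zeroʳ a)
  eval-∗ a (c ∷ cs) t = trans (+-congˡ (*-congˡ (eval-∗ a cs t)))
    (solve 4 (λ a c t p → a :* c :+ t :* (a :* p) := a :* (c :+ t :* p)) refl a c t (eval cs t))

  eval-+ : ∀ cs ds t → eval (cs +ᴾ ds) t ≈ eval cs t + eval ds t
  eval-+ []       ds       t = ≈-sym (+-identityˡ _)
  eval-+ (c ∷ cs) []       t = ≈-sym (+-identityʳ _)
  eval-+ (c ∷ cs) (d ∷ ds) t = trans (+-congˡ (*-congˡ (eval-+ cs ds t)))
    (solve 5 (λ c d t p q → c :+ d :+ t :* (p :+ q) := (c :+ t :* p) :+ (d :+ t :* q)) refl c d t (eval cs t) (eval ds t))

  eval-* : ∀ cs ds t → eval (cs *ᴾ ds) t ≈ eval cs t * eval ds t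
  eval-* []       ds t = ≈-sym (zeroˡ _)
  eval-* (c ∷ cs) ds t = begin
    eval (c ∗ᴾ ds +ᴾ (0# ∷ cs *ᴾ ds)) t                   ≈⟨ eval-+ (c ∗ᴾ ds) (0# ∷ cs *ᴾ ds) t ⟩
    eval (c ∗ᴾ ds) t + (0# + t * eval (cs *ᴾ ds) t)       ≈⟨ +-cong (eval-∗ c ds t) (+-congˡ (*-congˡ (eval-* cs ds t))) ⟩
    c * eval ds t + (0# + t * (eval cs t * eval ds t))    ≈⟨ solve 4 (λ c t p q → c :* q :+ (con (+ 0) :+ t :* (p :* q)) := (c :+ t :* p) :* q) refl c t (eval cs t) (eval ds t) ⟩
    (c + t * eval cs t) * eval ds t                       ∎

  0<2^n-1 : ∀ n → 0# < 2# ^ suc n - 1#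
  0<2^n-1 ℕ.zero  = <-respʳ-≈ (solve 0 (con (+ 1) := con (+ 2) :* con (+ 1) :- con (+ 1)) refl) 0<1
  0<2^n-1 (suc n) = <-respʳ-≈ (solve 1 (λ p → p :- con (+ 1) :+ (p :- con (+ 1)) :+ con (+ 1) := con (+ 2) :* p :- con (+ 1)) refl (2# ^ suc n))
    (+-pos (+-pos (0<2^n-1 n) (0<2^n-1 n)) 0<1)

  -- The coefficients of 2ᵈ f(t) - f(2t), where f = c + t g has degree d: the
  -- leading term cancels, and the constant term becomes (2ᵈ - 1) c.
  lowerDegree : Carrier → List Carrier → List Carrier
  lowerDegree c []       = []
  lowerDegree c (d ∷ cs) = (2# ^ suc (length cs) - 1#) * c ∷ 2# ∗ᴾ lowerDegree d cs

  length-lowerDegree : ∀ c cs → length (lowerDegree c cs) ≡ length cs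
  length-lowerDegree c []       = ≡.refl
  length-lowerDegree c (d ∷ cs) = ≡.cong suc (≡.trans (List.length-map (2# *_) (lowerDegree d cs)) (length-lowerDegree d cs))

  eval-lowerDegree : ∀ c cs t → eval (lowerDegree c cs) t ≈ 2# ^ length cs * eval (c ∷ cs) t - eval (c ∷ cs) (2# * t)
  eval-lowerDegree c []       t = solve 2 (λ c t → con (+ 0) := con (+ 1) :* (c :+ t :* con (+ 0)) :- (c :+ con (+ 2) :* t :* con (+ 0))) refl c t
  eval-lowerDegree c (d ∷ cs) t = begin
    (2# * p - 1#) * c + t * eval (2# ∗ᴾ lowerDegree d cs) t    ≈⟨ +-congˡ (*-congˡ (trans (eval-∗ 2# (lowerDegree d cs) t) (*-congˡ (eval-lowerDegree d cs t)))) ⟩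
    (2# * p - 1#) * c + t * (2# * (p * g - g′))                ≈⟨ solve 5 (λ p c t g g′ → (con (+ 2) :* p :- con (+ 1)) :* c :+ t :* (con (+ 2) :* (p :* g :- g′)) := con (+ 2) :* p :* (c :+ t :* g) :- (c :+ con (+ 2) :* t :* g′)) refl p c t g g′ ⟩
    2# * p * (c + t * g) - (c + 2# * t * g′)                   ∎
    where
    p g g′ : Carrier
    p  = 2# ^ length cs
    g  = eval (d ∷ cs) t
    g′ = eval (d ∷ cs) (2# * t)

  -- The hypothesis leaves out t = 0, as the substitution x = - 1/t will require, so c cannot be
  -- read off there. Passing to `lowerDegree` preserves vanishing, because 2 t is apart from zero
  -- along with t, and multiplies c by a positive number; at degree zero only c is left. The length
  -- k drives the recursion, since the new list is not a sublist.
  constantTerm≈0 : ∀ k c cs → length cs ≡ k → (∀ t → t # 0# → eval (c ∷ cs) t ≈ 0#) → c ≈ 0#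
  constantTerm≈0 ℕ.zero  c []       _  vanishes = trans (solve 1 (λ c → c := c :+ con (+ 1) :* con (+ 0)) refl c) (vanishes 1# 1#0)
  constantTerm≈0 (suc k) c (d ∷ cs) eq vanishes = *-cancelˡ (>⇒#0 (0<2^n-1 (length cs))) (trans
    (constantTerm≈0 k ((2# ^ suc (length cs) - 1#) * c) (2# ∗ᴾ lowerDegree d cs)
      (≡.trans (ℕ.suc-injective (length-lowerDegree c (d ∷ cs))) (ℕ.suc-injective eq)) lower)
    (≈-sym (zeroʳ _)))
    where
    lower : ∀ t → t # 0# → eval (lowerDegree c (d ∷ cs)) t ≈ 0#
    lower t t#0 = begin
      eval (lowerDegree c (d ∷ cs)) t    ≈⟨ eval-lowerDegree c (d ∷ cs) t ⟩
      _ * eval (c ∷ d ∷ cs) t - eval (c ∷ d ∷ cs) (2# * t)   ≈⟨ +-cong (*-congˡ (vanishes t t#0)) (-‿cong (vanishes (2# * t) (x#0y#0→xy#0 2#0 t#0))) ⟩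
      2# ^ suc (length cs) * 0# - 0#     ≈⟨ solve 1 (λ p → p :* con (+ 0) :- con (+ 0) := con (+ 0)) refl (2# ^ suc (length cs)) ⟩
      0#                                 ∎

  -- f is a polynomial function with constant term a and linear coefficient b.
  Jet : Carrier → Carrier → (Carrier → Carrier) → Set (c ⊔ ℓ₁)
  Jet a b f = ∃[ cs ] (∀ t → f t ≈ eval (a ∷ b ∷ cs) t)

  -- The difference vanishes away from zero, so its constant term is zero; division by t then turns
  -- the linear coefficient into a constant term.
  jet-unique : ∀ {a b a′ b′ f g} → Jet a b f → Jet a′ b′ g → (∀ t → t # 0# → f t ≈ g t) → a ≈ a′ × b ≈ b′
  jet-unique {a} {b} {a′} {b′} {f} {g} (cs , f≈) (ds , g≈) f≈g =
    difference≈0 a a′ a-a′≈0 , difference≈0 b b′ (constantTerm≈0 _ (b - b′) rs ≡.refl linear)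
    where
    rs : List Carrier
    rs = cs +ᴾ (- 1#) ∗ᴾ ds

    eval-rs : ∀ t → eval rs t ≈ eval cs t - eval ds t
    eval-rs t = begin
      eval rs t                             ≈⟨ eval-+ cs ((- 1#) ∗ᴾ ds) t ⟩
      eval cs t + eval ((- 1#) ∗ᴾ ds) t     ≈⟨ +-congˡ (eval-∗ (- 1#) ds t) ⟩
      eval cs t + - 1# * eval ds t          ≈⟨ solve 2 (λ p q → p :+ :- con (+ 1) :* q := p :- q) refl (eval cs t) (eval ds t) ⟩
      eval cs t - eval ds t                 ∎

    difference≈0 : ∀ x y → x - y ≈ 0# → x ≈ y
    difference≈0 x y x-y≈0 = trans (solve 2 (λ x y → x := x :- y :+ y) refl x y) (trans (+-congʳ x-y≈0) (+-identityˡ y))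

    difference : ∀ t → t # 0# → eval (a - a′ ∷ b - b′ ∷ rs) t ≈ 0#
    difference t t#0 = begin
      (a - a′) + t * ((b - b′) + t * eval rs t)                    ≈⟨ +-congˡ (*-congˡ (+-congˡ (*-congˡ (eval-rs t)))) ⟩
      (a - a′) + t * ((b - b′) + t * (eval cs t - eval ds t))      ≈⟨ solve 7 (λ a a′ b b′ t p q → a :- a′ :+ t :* (b :- b′ :+ t :* (p :- q)) := (a :+ t :* (b :+ t :* p)) :- (a′ :+ t :* (b′ :+ t :* q))) refl a a′ b b′ t (eval cs t) (eval ds t) ⟩
      eval (a ∷ b ∷ cs) t - eval (a′ ∷ b′ ∷ ds) t                  ≈⟨ +-cong (f≈ t) (-‿cong (g≈ t)) ⟨
      f t - g t                                                    ≈⟨ +-congʳ (f≈g t t#0) ⟩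
      g t - g t                                                    ≈⟨ -‿inverseʳ (g t) ⟩
      0#                                                           ∎

    a-a′≈0 : a - a′ ≈ 0#
    a-a′≈0 = constantTerm≈0 _ (a - a′) (b - b′ ∷ rs) ≡.refl difference

    linear : ∀ t → t # 0# → eval (b - b′ ∷ rs) t ≈ 0#
    linear t t#0 = *-cancelˡ t#0 (begin
      t * eval (b - b′ ∷ rs) t               ≈⟨ +-identityˡ _ ⟨
      0# + t * eval (b - b′ ∷ rs) t          ≈⟨ +-congʳ a-a′≈0 ⟨
      (a - a′) + t * eval (b - b′ ∷ rs) t    ≈⟨ difference t t#0 ⟩
      0#                                     ≈⟨ zeroʳ t ⟨
      t * 0#                                 ∎)

  jet-cong : ∀ {a b a′ b′ f g} → a ≈ a′ → b ≈ b′ → (∀ t → g t ≈ f t) → Jet a b f → Jet a′ b′ g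
  jet-cong a≈a′ b≈b′ g≈f (cs , f≈) = cs , λ t →
    trans (g≈f t) (trans (f≈ t) (+-cong a≈a′ (*-congˡ (+-congʳ b≈b′))))

  jet-linear : ∀ a b → Jet a b (λ t → a + t * b)
  jet-linear a b = [] , λ t → solve 3 (λ a b t → a :+ t :* b := a :+ t :* (b :+ t :* con (+ 0))) refl a b t

  jet-const : ∀ a → Jet a 0# (λ _ → a)
  jet-const a = [] , λ t → solve 2 (λ a t → a := a :+ t :* (con (+ 0) :+ t :* con (+ 0))) refl a t

  jet-+ : ∀ {a b a′ b′ f g} → Jet a b f → Jet a′ b′ g → Jet (a + a′) (b + b′) (λ t → f t + g t)
  jet-+ {a} {b} {a′} {b′} (cs , f≈) (ds , g≈) = cs +ᴾ ds , λ t →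
    trans (+-cong (f≈ t) (g≈ t)) (≈-sym (eval-+ (a ∷ b ∷ cs) (a′ ∷ b′ ∷ ds) t))

  jet-* : ∀ {a b a′ b′ f g} → Jet a b f → Jet a′ b′ g → Jet (a * a′) (a * b′ + a′ * b) (λ t → f t * g t)
  jet-* {a} {b} {a′} {b′} {f} {g} (cs , f≈) (ds , g≈) = rs , λ t → begin
    f t * g t                                        ≈⟨ *-cong (f≈ t) (g≈ t) ⟩
    eval (a ∷ b ∷ cs) t * eval (a′ ∷ b′ ∷ ds) t
      ≈⟨ solve 7 (λ a a′ b b′ t p q → (a :+ t :* (b :+ t :* p)) :* (a′ :+ t :* (b′ :+ t :* q))
           := a :* a′ :+ t :* (a :* b′ :+ a′ :* b :+ t :* (a :* q :+ a′ :* p :+ (b :+ t :* p) :* (b′ :+ t :* q))))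
           refl a a′ b b′ t (eval cs t) (eval ds t) ⟩
    a * a′ + t * (a * b′ + a′ * b + t * (a * eval ds t + a′ * eval cs t + eval (b ∷ cs) t * eval (b′ ∷ ds) t))
      ≈⟨ +-congˡ (*-congˡ (+-congˡ (*-congˡ (eval-rs t)))) ⟨
    eval (a * a′ ∷ a * b′ + a′ * b ∷ rs) t           ∎
    where
    rs : List Carrier
    rs = a ∗ᴾ ds +ᴾ a′ ∗ᴾ cs +ᴾ (b ∷ cs) *ᴾ (b′ ∷ ds)

    eval-rs : ∀ t → eval rs t ≈ a * eval ds t + a′ * eval cs t + eval (b ∷ cs) t * eval (b′ ∷ ds) t
    eval-rs t = trans (eval-+ (a ∗ᴾ ds +ᴾ a′ ∗ᴾ cs) _ t)
      (+-cong (trans (eval-+ (a ∗ᴾ ds) _ t) (+-cong (eval-∗ a ds t) (eval-∗ a′ cs t))) (eval-* (b ∷ cs) (b′ ∷ ds) t))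

  jet-sum : ∀ {n} (a b : Fin n → Carrier) (f : Fin n → Carrier → Carrier) →
            (∀ i → Jet (a i) (b i) (f i)) → Jet (sum a) (sum b) (λ t → ∑[ i < n ] f i t)
  jet-sum {ℕ.zero} a b f jets = jet-const 0#
  jet-sum {suc n}  a b f jets = jet-+ (jets zero) (jet-sum (a ∘ suc) (b ∘ suc) (f ∘ suc) (jets ∘ suc))

  -- Logarithmic differentiation: y stands for the quotients b / a. Supplying them by an equation
  -- serves both the factors (a - θ) + t, with y the inverses, and 1 + t θ, with y = θ.
  jet-product : ∀ {n} (a b y : Fin n → Carrier) → (∀ i → a i * y i ≈ b i) →
                Jet (product a) (product a * sum y) (λ t → product (λ i → a i + t * b i))
  jet-product {ℕ.zero} a b y ay≈b = jet-cong refl (≈-sym (zeroʳ 1#)) (λ _ → refl) (jet-const 1#)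
  jet-product {suc n}  a b y ay≈b = jet-cong refl derivative (λ _ → refl)
    (jet-* (jet-linear (a zero) (b zero)) (jet-product (a ∘ suc) (b ∘ suc) (y ∘ suc) (ay≈b ∘ suc)))
    where
    p : Carrier
    p = product (a ∘ suc)

    derivative : a zero * (p * sum (y ∘ suc)) + p * b zero ≈ a zero * p * (y zero + sum (y ∘ suc))
    derivative = begin
      a zero * (p * sum (y ∘ suc)) + p * b zero               ≈⟨ +-congˡ (*-congˡ (ay≈b zero)) ⟨
      a zero * (p * sum (y ∘ suc)) + p * (a zero * y zero)    ≈⟨ solve 4 (λ a p s y → a :* (p :* s) :+ p :* (a :* y) := a :* p :* (y :+ s)) refl (a zero) p (sum (y ∘ suc)) (y zero) ⟩
      a zero * p * (y zero + sum (y ∘ suc))                   ∎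

  -- The derivative of a determinant.

  -- The derivative of det (A + t B) at t = 0, by the product rule over columns.
  columnDerivative : ∀ {n} → Matrix n n → Matrix n n → Carrier
  columnDerivative {n} A B = ∑[ i < n ] det (A [ i ≔ (λ r → B r i) ])

  -- Both sides add the first-row expansion terms j of A with column i taken from B. For i = j the
  -- entry comes from B and the minor from A; for i ≠ j the entry comes from A and the replacement
  -- happens inside the minor.
  columnDerivative-expansion : ∀ {n} (A B : Matrix (suc n) (suc n)) →
    ∑[ j < suc n ] (sign j * B zero j * det (minor j A) + sign j * A zero j * columnDerivative (minor j A) (minor j B))
    ≈ columnDerivative A B
  columnDerivative-expansion {n} A B = begin
    ∑[ j < suc n ] (sign j * B zero j * det (minor j A) + sign j * A zero j * columnDerivative (minor j A) (minor j B))
      ≈⟨ sum-cong-≋ {suc n} column ⟨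
    ∑[ j < suc n ] ∑[ i < suc n ] G i j        ≈⟨ ∑-comm G ⟨
    ∑[ i < suc n ] ∑[ j < suc n ] G i j        ∎
    where
    G : Fin (suc n) → Fin (suc n) → Carrier
    G i j = expansionTerm (A [ i ≔ (λ r → B r i) ]) j

    diagonal : ∀ j → G j j ≈ sign j * B zero j * det (minor j A)
    diagonal j = *-cong (*-congˡ {sign j} (reflexive (≔-updates A j (λ r → B r j) zero)))
      (det-cong _ (minor j A) (λ r k → reflexive (≔-minimal A j (λ r → B r j) (suc r) (punchInᵢ≢i j k))))

    offDiagonal : ∀ j i′ → G (punchIn j i′) j ≈ sign j * A zero j * det (minor j A [ i′ ≔ (λ r → minor j B r i′) ])
    offDiagonal j i′ = *-cong (*-congˡ {sign j} (reflexive (≔-minimal A i (λ r → B r i) zero (punchInᵢ≢i j i′ ∘ ≡.sym))))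
      (det-cong _ (minor j A [ i′ ≔ v ]) minors)
      where
      i : Fin (suc n)
      i = punchIn j i′

      v : Column n
      v r = minor j B r i′

      minors : minor j (A [ i ≔ (λ r → B r i) ]) ≋ minor j A [ i′ ≔ v ]
      minors r k with k ≟ i′
      ... | yes ≡.refl = reflexive (≡.trans (≔-updates A i (λ r → B r i) (suc r)) (≡.sym (≔-updates (minor j A) i′ v r)))
      ... | no k≢i′    = reflexive (≡.trans (≔-minimal A i (λ r → B r i) (suc r) (k≢i′ ∘ punchIn-injective j k i′))
                                            (≡.sym (≔-minimal (minor j A) i′ v r k≢i′)))

    column : ∀ j → ∑[ i < suc n ] G i j ≈
             sign j * B zero j * det (minor j A) + sign j * A zero j * columnDerivative (minor j A) (minor j B)
    column j = begin
      ∑[ i < suc n ] G i j                            ≈⟨ sum-remove {i = j} (λ i → G i j) ⟩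
      G j j + ∑[ i′ < n ] G (punchIn j i′) j          ≈⟨ +-cong (diagonal j) (sum-cong-≋ {n} (offDiagonal j)) ⟩
      sign j * B zero j * det (minor j A) + ∑[ i′ < n ] (sign j * A zero j * det (minor j A [ i′ ≔ (λ r → minor j B r i′) ]))
        ≈⟨ +-congˡ (*-distribˡ-sum (sign j * A zero j) (λ i′ → det (minor j A [ i′ ≔ (λ r → minor j B r i′) ]))) ⟨
      sign j * B zero j * det (minor j A) + sign j * A zero j * columnDerivative (minor j A) (minor j B)  ∎

  jet-det : ∀ {n} (A B : Matrix n n) → Jet (det A) (columnDerivative A B) (λ t → det (λ i j → A i j + t * B i j))
  jet-det {ℕ.zero} A B = jet-const 1#
  jet-det {suc n}  A B = jet-cong refl (columnDerivative-expansion A B) (λ _ → refl)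
    (jet-sum (expansionTerm A) _ (λ j t → sign j * (A zero j + t * B zero j) * det (λ i k → minor j A i k + t * minor j B i k)) term)
    where
    term : ∀ j → Jet (expansionTerm A j)
                     (sign j * B zero j * det (minor j A) + sign j * A zero j * columnDerivative (minor j A) (minor j B))
                     (λ t → sign j * (A zero j + t * B zero j) * det (λ i k → minor j A i k + t * minor j B i k))
    term j = jet-cong refl
      (solve 5 (λ s a b d d′ → s :* a :* d′ :+ d :* (s :* b :+ a :* con (+ 0)) := s :* b :* d :+ s :* a :* d′) refl
        (sign j) (A zero j) (B zero j) (det (minor j A)) (columnDerivative (minor j A) (minor j B)))
      (λ _ → refl)
      (jet-* (jet-* (jet-const (sign j)) (jet-linear (A zero j) (B zero j))) (jet-det (minor j A) (minor j B)))

  -- If A X = B, Cramer's rule evaluates every term of the column derivative.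
  jet-det-tr : ∀ {n} (A B X : Matrix n n) → A ⊗ X ≋ B → Jet (det A) (det A * tr X) (λ t → det (λ i j → A i j + t * B i j))
  jet-det-tr {n} A B X AX≋B = jet-cong refl derivative (λ _ → refl) (jet-det A B)
    where
    derivative : columnDerivative A B ≈ det A * tr X
    derivative = begin
      columnDerivative A B            ≈⟨ sum-cong-≋ {n} (λ i → cramer A (λ k → X k i) (λ r → B r i) (λ r → AX≋B r i) i) ⟩
      ∑[ i < n ] (X i i * det A)      ≈⟨ *-distribʳ-sum (det A) (λ i → X i i) ⟨
      tr X * det A                    ≈⟨ *-comm (tr X) (det A) ⟩
      det A * tr X                    ∎

  det-scale : ∀ {n} a (A : Matrix n n) (x : Fin n → Carrier) → det A ≈ product x →
              det (a ⊙ A) ≈ product (λ i → a * x i)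
  det-scale {n} a A x detA≈ = trans (det-⊙ a A) (trans (*-congˡ detA≈) (≈-sym (product-scale a x)))
    where
    det-⊙ : ∀ {n} a (A : Matrix n n) → det (a ⊙ A) ≈ a ^ n * det A
    det-⊙ {ℕ.zero} a A = ≈-sym (*-identityˡ 1#)
    det-⊙ {suc n}  a A = begin
      sum (expansionTerm (a ⊙ A))                       ≈⟨ sum-cong-≋ {suc n} (λ j → trans (*-congˡ {sign j * (a * A zero j)} (det-⊙ a (minor j A)))
                                                              (solve 5 (λ s a x p d → s :* (a :* x) :* (p :* d) := a :* p :* (s :* x :* d)) refl (sign j) a (A zero j) (a ^ n) (det (minor j A)))) ⟩
      ∑[ j < suc n ] (a * a ^ n * expansionTerm A j)    ≈⟨ *-distribˡ-sum (a * a ^ n) (expansionTerm A) ⟨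
      a ^ suc n * det A                                 ∎

    product-scale : ∀ {n} a (x : Fin n → Carrier) → product (λ i → a * x i) ≈ a ^ n * product x
    product-scale {ℕ.zero} a x = ≈-sym (*-identityˡ 1#)
    product-scale {suc n}  a x = trans (*-congˡ (product-scale a (x ∘ suc)))
      (solve 4 (λ a x p q → a :* x :* (p :* q) := a :* p :* (x :* q)) refl a (x zero) (a ^ n) (product (x ∘ suc)))

  product-#0 : ∀ {n} (f : Fin n → Carrier) → product f # 0# → ∀ i → f i # 0#
  product-#0 f ∏#0 zero    = *-#0ˡ ∏#0
  product-#0 f ∏#0 (suc i) = product-#0 (f ∘ suc) (*-#0ʳ ∏#0) i

  product-1 : ∀ n → product {n} (λ _ → 1#) ≈ 1#
  product-1 ℕ.zero  = refl
  product-1 (suc n) = trans (*-identityˡ _) (product-1 n)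

  -- Eigenvalues as roots of the characteristic polynomial.

  eigenvalues-#0 : ∀ {n} (A : Matrix n n) θ → Eigenvalues A θ → ∀ a → det (a ⊙ I ⊖ A) # 0# → ∀ i → a - θ i # 0#
  eigenvalues-#0 A θ eig a det#0 = product-#0 (λ i → a - θ i) (#-congʳ (eig a) det#0)

  -- Shift the variable to x = a + t. The linear coefficient is det N tr N⁻¹ on the matrix side and
  -- the product of the a - θ times the sum of their inverses on the root side; the common constant
  -- term cancels.
  eigenvalues-sum-inverse : ∀ {n} (A : Matrix n n) θ → Eigenvalues A θ → ∀ a → det (a ⊙ I ⊖ A) # 0# →
                            (X : Matrix n n) → (a ⊙ I ⊖ A) ⊗ X ≋ I →
                            (y : Fin n → Carrier) → (∀ i → (a - θ i) * y i ≈ 1#) → sum y ≈ tr X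
  eigenvalues-sum-inverse {n} A θ eig a det#0 X NX≋I y δy≈1 = *-cancelˡ det#0 (begin
    det N * sum y                       ≈⟨ *-congʳ (proj₁ jets) ⟩
    product (λ i → a - θ i) * sum y     ≈⟨ proj₂ jets ⟨
    det N * tr X                        ∎)
    where
    N : Matrix n n
    N = a ⊙ I ⊖ A

    charpoly : ∀ t → t # 0# → det (λ i j → N i j + t * I i j) ≈ product (λ i → (a - θ i) + t * 1#)
    charpoly t _ = begin
      det (λ i j → N i j + t * I i j)     ≈⟨ det-cong _ ((a + t) ⊙ I ⊖ A) (λ i j → solve 4 (λ a δ x t → a :* δ :- x :+ t :* δ := (a :+ t) :* δ :- x) refl a (I i j) (A i j) t) ⟩
      det ((a + t) ⊙ I ⊖ A)               ≈⟨ eig (a + t) ⟩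
      product (λ i → (a + t) - θ i)       ≈⟨ product-cong {n} (λ i → solve 3 (λ a t x → (a :+ t) :- x := (a :- x) :+ t :* con (+ 1)) refl a t (θ i)) ⟩
      product (λ i → (a - θ i) + t * 1#)  ∎

    jets : det N ≈ product (λ i → a - θ i) × det N * tr X ≈ product (λ i → a - θ i) * sum y
    jets = jet-unique (jet-det-tr N I X NX≋I) (jet-product (λ i → a - θ i) (λ _ → 1#) y δy≈1) charpoly

  -- The reversed characteristic polynomial det (I + t A) brings the point x = ∞ to t = 0. Its
  -- linear coefficient is tr A, and that of ∏ (1 + t θ) is ∑ θ.
  eigenvalues-sum : ∀ {n} (A : Matrix n n) θ → Eigenvalues A θ → sum θ ≈ tr A
  eigenvalues-sum {n} A θ eig = begin
    sum θ                                ≈⟨ *-identityˡ (sum θ) ⟨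
    1# * sum θ                           ≈⟨ *-congʳ (product-1 n) ⟨
    product {n} (λ _ → 1#) * sum θ       ≈⟨ proj₂ jets ⟨
    det (I {n}) * tr A                   ≈⟨ *-congʳ (trans (proj₁ jets) (product-1 n)) ⟩
    1# * tr A                            ≈⟨ *-identityˡ (tr A) ⟩
    tr A                                 ∎
    where
    -- I + t A = - t (x I - A) for x = - 1/t.
    charpoly : ∀ t → t # 0# → det (λ i j → I i j + t * A i j) ≈ product (λ i → 1# + t * θ i)
    charpoly t t#0 = begin
      det (λ i j → I i j + t * A i j)              ≈⟨ det-cong _ ((- t) ⊙ ((- s) ⊙ I ⊖ A)) (λ i j → trans (+-congʳ (≈-sym (trans (*-congʳ (*-inverseʳ t#0)) (*-identityˡ (I i j)))))
                                                        (solve 4 (λ t s δ x → t :* s :* δ :+ t :* x := :- t :* (:- s :* δ :- x)) refl t s (I i j) (A i j))) ⟩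
      det ((- t) ⊙ ((- s) ⊙ I ⊖ A))                ≈⟨ det-scale (- t) ((- s) ⊙ I ⊖ A) (λ i → - s - θ i) (eig (- s)) ⟩
      product (λ i → - t * (- s - θ i))            ≈⟨ product-cong {n} (λ i → trans (solve 3 (λ t s x → :- t :* (:- s :- x) := t :* s :+ t :* x) refl t s (θ i)) (+-congʳ (*-inverseʳ t#0))) ⟩
      product (λ i → 1# + t * θ i)                 ∎
      where
      s : Carrier
      s = inverse t#0

    jets : det (I {n}) ≈ product {n} (λ _ → 1#) × det (I {n}) * tr A ≈ product {n} (λ _ → 1#) * sum θ
    jets = jet-unique (jet-det-tr I A A (⊗-identityˡ A)) (jet-product (λ _ → 1#) θ θ (λ i → *-identityˡ (θ i))) charpoly

  -- The Laplacian of a graph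

  if-yes : ∀ {a} {P : Set a} (P? : Dec P) {x y} → P → (if does P? then x else y) ≈ x
  if-yes (yes _) _ = refl
  if-yes (no ¬p) p = contradiction p ¬p

  if-no : ∀ {a} {P : Set a} (P? : Dec P) {x y} → ¬ P → (if does P? then x else y) ≈ y
  if-no (yes p) ¬p = contradiction p ¬p
  if-no (no _)  _  = refl

  module _ {n : ℕ} (G : SimpleGraph n) where

    open SimpleGraph G

    private
      a : Matrix n n
      a = adjacency G

    adjacency-yes : ∀ {x y} → Adj x y → a x y ≈ 1#
    adjacency-yes {x} {y} = if-yes (Adj? x y)

    adjacency-no : ∀ {x y} → ¬ Adj x y → a x y ≈ 0#
    adjacency-no {x} {y} = if-no (Adj? x y)

    adjacency-symmetric : ∀ x y → a x y ≈ a y x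
    adjacency-symmetric x y with Adj? x y
    ... | yes xy = ≈-sym (adjacency-yes (sym xy))
    ... | no ¬xy = ≈-sym (adjacency-no (¬xy ∘ sym))

    laplacian+J : Matrix n n
    laplacian+J x y = laplacian G x y + 1#

    laplacian-rowSum : ∀ x → sum (laplacian G x) ≈ 0#
    laplacian-rowSum x = begin
      ∑[ y < n ] (sum (a x) * I x y - a x y)         ≈⟨ sum-minus (λ y → sum (a x) * I x y) (a x) ⟩
      ∑[ y < n ] (sum (a x) * I x y) - sum (a x)     ≈⟨ +-congʳ (sum-cong-≋ {n} (λ y → *-congˡ (I-sym x y))) ⟩
      ∑[ y < n ] (sum (a x) * I y x) - sum (a x)     ≈⟨ +-congʳ (sum-Iʳ (λ _ → sum (a x)) x) ⟩
      sum (a x) - sum (a x)                          ≈⟨ -‿inverseʳ (sum (a x)) ⟩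
      0#                                             ∎

    module _ (u : Column n) where

      private
        s : Carrier
        s = sum u

        -- The Dirichlet energy over ordered pairs, counting each edge twice. The form uᵀ L u is
        -- `halfEnergy`; adding its copy with x and y exchanged completes the squares.
        energy : Carrier
        energy = ∑[ x < n ] ∑[ y < n ] (a x y * ((u x - u y) * (u x - u y)))

        halfEnergy : Carrier
        halfEnergy = ∑[ x < n ] ∑[ y < n ] (u x * (a x y * (u x - u y)))

        apply : ∀ x → (laplacian+J ⊛ u) x ≈ ∑[ y < n ] (a x y * (u x - u y)) + s
        apply x = begin
          ∑[ y < n ] ((d * I x y - a x y + 1#) * u y)
            ≈⟨ sum-cong-≋ {n} (λ y → solve 4 (λ d δ a u → (d :* δ :- a :+ con (+ 1)) :* u := d :* (δ :* u) :- a :* u :+ u) refl d (I x y) (a x y) (u y)) ⟩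
          ∑[ y < n ] (d * (I x y * u y) - a x y * u y + u y)
            ≈⟨ trans (∑-distrib-+ (λ y → d * (I x y * u y) - a x y * u y) u) (+-congʳ (sum-minus (λ y → d * (I x y * u y)) (λ y → a x y * u y))) ⟩
          ∑[ y < n ] (d * (I x y * u y)) - ∑[ y < n ] (a x y * u y) + s
            ≈⟨ +-congʳ (+-congʳ (trans (≈-sym (*-distribˡ-sum d (λ y → I x y * u y))) (*-congˡ (sum-Iˡ u x)))) ⟩
          d * u x - ∑[ y < n ] (a x y * u y) + s
            ≈⟨ +-congʳ (+-congʳ (*-distribʳ-sum (u x) (a x))) ⟩
          ∑[ y < n ] (a x y * u x) - ∑[ y < n ] (a x y * u y) + s
            ≈⟨ +-congʳ (sum-minus (λ y → a x y * u x) (λ y → a x y * u y)) ⟨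
          ∑[ y < n ] (a x y * u x - a x y * u y) + s
            ≈⟨ +-congʳ (sum-cong-≋ {n} (λ y → solve 3 (λ a v w → a :* v :- a :* w := a :* (v :- w)) refl (a x y) (u x) (u y))) ⟩
          ∑[ y < n ] (a x y * (u x - u y)) + s  ∎
          where
          d : Carrier
          d = sum (a x)

        form : u ∙ (laplacian+J ⊛ u) ≈ halfEnergy + s * s
        form = begin
          ∑[ x < n ] (u x * (laplacian+J ⊛ u) x)                               ≈⟨ sum-cong-≋ {n} (λ x → trans (*-congˡ (apply x)) (distribˡ (u x) _ s)) ⟩
          ∑[ x < n ] (u x * ∑[ y < n ] (a x y * (u x - u y)) + u x * s)        ≈⟨ ∑-distrib-+ (λ x → u x * ∑[ y < n ] (a x y * (u x - u y))) (λ x → u x * s) ⟩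
          ∑[ x < n ] (u x * ∑[ y < n ] (a x y * (u x - u y))) + ∑[ x < n ] (u x * s)
            ≈⟨ +-cong (sum-cong-≋ {n} (λ x → *-distribˡ-sum (u x) (λ y → a x y * (u x - u y)))) (≈-sym (*-distribʳ-sum s u)) ⟩
          halfEnergy + s * s                                                   ∎

        doubled : halfEnergy + halfEnergy ≈ energy
        doubled = begin
          halfEnergy + halfEnergy
            ≈⟨ +-congˡ (∑-comm (λ x y → u x * (a x y * (u x - u y)))) ⟩
          halfEnergy + ∑[ x < n ] ∑[ y < n ] (u y * (a y x * (u y - u x)))
            ≈⟨ ∑-distrib-+ (λ x → ∑[ y < n ] (u x * (a x y * (u x - u y)))) (λ x → ∑[ y < n ] (u y * (a y x * (u y - u x)))) ⟨
          ∑[ x < n ] (∑[ y < n ] (u x * (a x y * (u x - u y))) + ∑[ y < n ] (u y * (a y x * (u y - u x))))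
            ≈⟨ sum-cong-≋ {n} (λ x → ∑-distrib-+ (λ y → u x * (a x y * (u x - u y))) (λ y → u y * (a y x * (u y - u x)))) ⟨
          ∑[ x < n ] ∑[ y < n ] (u x * (a x y * (u x - u y)) + u y * (a y x * (u y - u x)))
            ≈⟨ sum-cong-≋ {n} (λ x → sum-cong-≋ {n} (λ y → trans (+-congˡ (*-congˡ (*-congʳ (adjacency-symmetric y x))))
                 (solve 3 (λ v w a → v :* (a :* (v :- w)) :+ w :* (a :* (w :- v)) := a :* ((v :- w) :* (v :- w))) refl (u x) (u y) (a x y)))) ⟩
          energy  ∎

        doubledForm : u ∙ (laplacian+J ⊛ u) + u ∙ (laplacian+J ⊛ u) ≈ energy + (s * s + s * s)
        doubledForm = trans (+-cong form form)
          (trans (solve 2 (λ h q → (h :+ q) :+ (h :+ q) := (h :+ h) :+ (q :+ q)) refl halfEnergy (s * s)) (+-congʳ doubled))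

        term-nonNeg : ∀ x y → NonNegative (a x y * ((u x - u y) * (u x - u y)))
        term-nonNeg x y with Adj? x y
        ... | yes _ = NonNegative-resp-≈ (≈-sym (*-identityˡ _)) (square-nonNeg (u x - u y))
        ... | no _  = NonNegative-resp-≈ (≈-sym (zeroˡ _)) 0-nonNeg

        energy-nonNeg : NonNegative energy
        energy-nonNeg = sum-nonNeg (λ x → ∑[ y < n ] (a x y * ((u x - u y) * (u x - u y)))) (λ x → sum-nonNeg (λ y → a x y * ((u x - u y) * (u x - u y))) (term-nonNeg x))

        2s²-nonNeg : NonNegative (s * s + s * s)
        2s²-nonNeg = +-nonNeg (square-nonNeg s) (square-nonNeg s)

        edge⇒pos : ∀ {x y} → Adj x y → u x - u y # 0# → 0# < energy
        edge⇒pos {x} {y} xy ux-uy#0 = sum-pos (λ x → ∑[ y < n ] (a x y * ((u x - u y) * (u x - u y))))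
          (λ x → sum-nonNeg (λ y → a x y * ((u x - u y) * (u x - u y))) (term-nonNeg x)) x
          (sum-pos (λ y → a x y * ((u x - u y) * (u x - u y))) (term-nonNeg x) y
            (<-respʳ-≈ (≈-sym (trans (*-congʳ (adjacency-yes xy)) (*-identityˡ _))) (x#0⇒0<x² ux-uy#0)))

        -- The difference of u between the ends is the difference over the first edge plus that over
        -- the rest. One of the two is apart from zero, so the descent meets an edge across which u
        -- changes.
        path⇒pos : ∀ {x y} → Star Adj x y → u x - u y # 0# → 0# < energy
        path⇒pos {x} ε ux-ux#0 = contradiction ux-ux#0 (#-irrefl (-‿inverseʳ (u x)))
        path⇒pos {x} {y} (_◅_ {j = z} xz path) ux-uy#0
          with +-#0 (#-congʳ (solve 3 (λ v w z → v :- w := (v :- z) :+ (z :- w)) refl (u x) (u y) (u z)) ux-uy#0)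
        ... | inj₁ ux-uz#0 = edge⇒pos xz ux-uz#0
        ... | inj₂ uz-uy#0 = path⇒pos path uz-uy#0

      laplacian+J-nonNeg : NonNegative (u ∙ (laplacian+J ⊛ u))
      laplacian+J-nonNeg = x+x-nonNeg⇒nonNeg (NonNegative-resp-≈ (≈-sym doubledForm) (+-nonNeg energy-nonNeg 2s²-nonNeg))

      -- n uᵢ = ∑ⱼ (uᵢ - uⱼ) + s, so either s or some difference is apart from zero.
      laplacian+J-pos : Connected G → fromℕ n # 0# → ∀ i → u i # 0# → 0# < u ∙ (laplacian+J ⊛ u)
      laplacian+J-pos connected n#0 i uᵢ#0 = x+x-pos⇒pos (<-respʳ-≈ (≈-sym doubledForm) positive)
        where
        split : fromℕ n * u i ≈ ∑[ j < n ] (u i - u j) + s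
        split = begin
          fromℕ n * u i                              ≈⟨ sum-const n (u i) ⟨
          ∑[ j < n ] u i                             ≈⟨ solve 2 (λ p q → p := (p :- q) :+ q) refl (∑[ j < n ] u i) s ⟩
          (∑[ j < n ] u i - s) + s                   ≈⟨ +-congʳ (sum-minus (λ _ → u i) u) ⟨
          ∑[ j < n ] (u i - u j) + s                 ∎

        positive : 0# < energy + (s * s + s * s)
        positive with +-#0 (#-congʳ split (x#0y#0→xy#0 n#0 uᵢ#0))
        ... | inj₂ s#0 = <-respʳ-≈ (+-comm _ _) (pos+nonNeg (+-pos (x#0⇒0<x² s#0) (x#0⇒0<x² s#0)) energy-nonNeg)
        ... | inj₁ ∑#0 with sum-#0 (λ j → u i - u j) ∑#0
        ...   | j , uᵢ-uⱼ#0 = pos+nonNeg (path⇒pos (connected i j) uᵢ-uⱼ#0) 2s²-nonNeg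

    laplacian+J-positiveDefinite : Connected G → fromℕ n # 0# → PositiveDefinite laplacian+J
    laplacian+J-positiveDefinite connected n#0 u (i , uᵢ#0) = laplacian+J-pos u connected n#0 i uᵢ#0

  -- The complete graph with the edges of F deleted.

  module _ {n p : ℕ} (F : OrientedEdges (complete n) p) where

    open OrientedEdges F

    private
      G : SimpleGraph n
      G = complete n ∖ F

      B : Matrix n p
      B = incidence F

      tail≢head : ∀ α → tail α ≢ head α
      tail≢head = isEdge

      -- The indicator of `Joins`, written with products of identity entries so that sums over
      -- vertices collapse. Its two summands cannot both be 1, as an edge has distinct ends.
      joins : Fin p → Fin n → Fin n → Carrier
      joins α x y = I x (tail α) * I y (head α) + I y (tail α) * I x (head α)

      deletedDegree : Fin n → Carrier
      deletedDegree x = ∑[ α < p ] (I x (tail α) + I x (head α))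

      I-product-≢ : ∀ (x y u v : Fin n) → ¬ (u ≡ x × v ≡ y) → I x u * I y v ≈ 0#
      I-product-≢ x y u v ¬xy with u ≟ x
      ... | yes u≡x = trans (*-congˡ (I-≢ (λ y≡v → ¬xy (u≡x , ≡.sym y≡v)))) (zeroʳ _)
      ... | no u≢x  = trans (*-congʳ (I-≢ (u≢x ∘ ≡.sym))) (zeroˡ _)

      I-product-≡ : ∀ (x y u v : Fin n) → u ≡ x → v ≡ y → I x u * I y v ≈ 1#
      I-product-≡ x y u v u≡x v≡y = trans (*-cong (I-≡ (≡.sym u≡x)) (I-≡ (≡.sym v≡y))) (*-identityˡ 1#)

      joins-no : ∀ α x y → ¬ Joins α x y → joins α x y ≈ 0#
      joins-no α x y ¬j = trans (+-cong (I-product-≢ x y (tail α) (head α) (¬j ∘ inj₁)) (I-product-≢ y x (tail α) (head α) (¬j ∘ inj₂))) (+-identityˡ 0#)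

      joins-yes : ∀ α x y → Joins α x y → joins α x y ≈ 1#
      joins-yes α x y (inj₁ (t≡x , h≡y)) = trans (+-cong (I-product-≡ x y (tail α) (head α) t≡x h≡y)
        (I-product-≢ y x (tail α) (head α) (λ (_ , h≡x) → tail≢head α (≡.trans t≡x (≡.sym h≡x))))) (+-identityʳ 1#)
      joins-yes α x y (inj₂ (t≡y , h≡x)) = trans (+-cong
        (I-product-≢ x y (tail α) (head α) (λ (t≡x , _) → tail≢head α (≡.trans t≡x (≡.sym h≡x)))) (I-product-≡ y x (tail α) (head α) t≡y h≡x)) (+-identityˡ 1#)

      same-pair : ∀ {α β x y} → Joins α x y → Joins β x y → α ≡ β
      same-pair {α} {β} (inj₁ (≡.refl , ≡.refl)) (inj₁ (t≡ , h≡)) = distinct α β (inj₁ (≡.sym t≡ , ≡.sym h≡))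
      same-pair {α} {β} (inj₁ (≡.refl , ≡.refl)) (inj₂ (t≡ , h≡)) = distinct α β (inj₂ (≡.sym h≡ , ≡.sym t≡))
      same-pair {α} {β} (inj₂ (≡.refl , ≡.refl)) (inj₁ (t≡ , h≡)) = distinct α β (inj₂ (≡.sym h≡ , ≡.sym t≡))
      same-pair {α} {β} (inj₂ (≡.refl , ≡.refl)) (inj₂ (t≡ , h≡)) = distinct α β (inj₁ (≡.sym t≡ , ≡.sym h≡))

      joins-irreflexive : ∀ {α x y} → x ≡ y → ¬ Joins α x y
      joins-irreflexive {α} ≡.refl (inj₁ (t≡x , h≡x)) = tail≢head α (≡.trans t≡x (≡.sym h≡x))
      joins-irreflexive {α} ≡.refl (inj₂ (t≡x , h≡x)) = tail≢head α (≡.trans t≡x (≡.sym h≡x))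

      -- By `same-pair` at most one deleted edge joins x and y, so the sum of `joins` is itself an
      -- indicator and not a larger count.
      adjacency-formula : ∀ x y → adjacency G x y ≈ 1# - I x y - ∑[ α < p ] joins α x y
      adjacency-formula x y = cases (x ≟ y) (any? (λ α → (tail α ≟ x ×-dec head α ≟ y) ⊎-dec (tail α ≟ y ×-dec head α ≟ x)))
        where
        cases : Dec (x ≡ y) → Dec (∃[ α ] Joins α x y) → adjacency G x y ≈ 1# - I x y - ∑[ α < p ] joins α x y
        cases (yes x≡y) _ = begin
          adjacency G x y                       ≈⟨ adjacency-no G {x} {y} (λ (x≢y , _) → x≢y x≡y) ⟩
          0#                                    ≈⟨ solve 0 (con (+ 0) := con (+ 1) :- con (+ 1) :- con (+ 0)) refl ⟩
          1# - 1# - 0#                          ≈⟨ +-cong (+-congˡ (-‿cong (I-≡ x≡y))) (-‿cong (sum-zero (λ α → joins α x y) (λ α → joins-no α x y (joins-irreflexive {α} x≡y)))) ⟨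
          1# - I x y - ∑[ α < p ] joins α x y   ∎
        cases (no x≢y) (yes (α , j)) = begin
          adjacency G x y                       ≈⟨ adjacency-no G {x} {y} (λ (_ , ¬j) → ¬j (α , j)) ⟩
          0#                                    ≈⟨ solve 0 (con (+ 0) := con (+ 1) :- con (+ 0) :- con (+ 1)) refl ⟩
          1# - 0# - 1#                          ≈⟨ +-cong (+-congˡ (-‿cong (I-≢ x≢y))) (-‿cong (trans (sum-single (λ β → joins β x y) α (λ β β≢α → joins-no β x y (λ j′ → β≢α (same-pair j′ j)))) (joins-yes α x y j))) ⟨
          1# - I x y - ∑[ β < p ] joins β x y   ∎
        cases (no x≢y) (no ¬j) = begin
          adjacency G x y                       ≈⟨ adjacency-yes G {x} {y} (x≢y , ¬j) ⟩
          1#                                    ≈⟨ solve 0 (con (+ 1) := con (+ 1) :- con (+ 0) :- con (+ 0)) refl ⟩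
          1# - 0# - 0#                          ≈⟨ +-cong (+-congˡ (-‿cong (I-≢ x≢y))) (-‿cong (sum-zero (λ α → joins α x y) (λ α → joins-no α x y (λ j → ¬j (α , j))))) ⟨
          1# - I x y - ∑[ α < p ] joins α x y   ∎

      sum-I : ∀ (x : Fin n) → ∑[ z < n ] I z x ≈ 1#
      sum-I x = trans (sum-cong-≋ {n} (λ z → ≈-sym (*-identityˡ (I z x)))) (sum-Iʳ (λ _ → 1#) x)

      degree-formula : ∀ x → ∑[ z < n ] adjacency G x z ≈ fromℕ n - 1# - deletedDegree x
      degree-formula x = begin
        ∑[ z < n ] adjacency G x z                                               ≈⟨ sum-cong-≋ {n} (adjacency-formula x) ⟩
        ∑[ z < n ] (1# - I x z - ∑[ α < p ] joins α x z)                         ≈⟨ trans (sum-minus (λ z → 1# - I x z) (λ z → ∑[ α < p ] joins α x z)) (+-congʳ (sum-minus (λ _ → 1#) (I x))) ⟩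
        ∑[ z < n ] 1# - ∑[ z < n ] I x z - ∑[ z < n ] ∑[ α < p ] joins α x z
          ≈⟨ +-cong (+-cong (trans (sum-const n 1#) (*-identityʳ _)) (-‿cong (trans (sum-cong-≋ {n} (I-sym x)) (sum-I x)))) (-‿cong incident) ⟩
        fromℕ n - 1# - deletedDegree x                                           ∎
        where
        incident : ∑[ z < n ] ∑[ α < p ] joins α x z ≈ deletedDegree x
        incident = trans (∑-comm (λ z α → joins α x z)) (sum-cong-≋ {p} (λ α → begin
          ∑[ z < n ] (I x (tail α) * I z (head α) + I z (tail α) * I x (head α))
            ≈⟨ ∑-distrib-+ (λ z → I x (tail α) * I z (head α)) (λ z → I z (tail α) * I x (head α)) ⟩
          ∑[ z < n ] (I x (tail α) * I z (head α)) + ∑[ z < n ] (I z (tail α) * I x (head α))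
            ≈⟨ +-cong (sum-Iʳ (λ _ → I x (tail α)) (head α)) (trans (≈-sym (*-distribʳ-sum (I x (head α)) (λ z → I z (tail α)))) (trans (*-congʳ (sum-I (tail α))) (*-identityˡ _))) ⟩
          I x (tail α) + I x (head α) ∎))

      I-product : ∀ (x y z : Fin n) → I x z * I y z ≈ I x z * I x y
      I-product x y z with x ≟ z
      ... | yes ≡.refl = *-congˡ (I-sym y x)
      ... | no _       = trans (zeroˡ _) (≈-sym (zeroˡ _))

      -- This is degree matrix minus adjacency matrix for the graph formed by the edges of F. The
      -- mixed products give `joins`; the others are nonzero only for x = y.
      BBᵀ-formula : ∀ x y → (B ⊗ B ᵀ) x y ≈ deletedDegree x * I x y - ∑[ α < p ] joins α x y
      BBᵀ-formula x y = begin
        ∑[ α < p ] ((I x (tail α) - I x (head α)) * (I y (tail α) - I y (head α)))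
          ≈⟨ sum-cong-≋ {p} (λ α → begin
               (I x (tail α) - I x (head α)) * (I y (tail α) - I y (head α))
                 ≈⟨ solve 4 (λ a b c d → (a :- b) :* (c :- d) := (a :* c :+ b :* d) :- (a :* d :+ c :* b)) refl (I x (tail α)) (I x (head α)) (I y (tail α)) (I y (head α)) ⟩
               (I x (tail α) * I y (tail α) + I x (head α) * I y (head α)) - joins α x y
                 ≈⟨ +-congʳ (+-cong (I-product x y (tail α)) (I-product x y (head α))) ⟩
               (I x (tail α) * I x y + I x (head α) * I x y) - joins α x y
                 ≈⟨ +-congʳ (distribʳ (I x y) (I x (tail α)) (I x (head α))) ⟨
               (I x (tail α) + I x (head α)) * I x y - joins α x y ∎) ⟩
        ∑[ α < p ] ((I x (tail α) + I x (head α)) * I x y - joins α x y)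
          ≈⟨ sum-minus (λ α → (I x (tail α) + I x (head α)) * I x y) (λ α → joins α x y) ⟩
        ∑[ α < p ] ((I x (tail α) + I x (head α)) * I x y) - ∑[ α < p ] joins α x y
          ≈⟨ +-congʳ (*-distribʳ-sum (I x y) (λ α → I x (tail α) + I x (head α))) ⟨
        deletedDegree x * I x y - ∑[ α < p ] joins α x y  ∎

    laplacian+J-formula : laplacian+J G ≋ fromℕ n ⊙ I ⊖ B ⊗ B ᵀ
    laplacian+J-formula x y = begin
      ∑[ z < n ] adjacency G x z * I x y - adjacency G x y + 1#
        ≈⟨ +-congʳ (+-cong (*-congʳ (degree-formula x)) (-‿cong (adjacency-formula x y))) ⟩
      (fromℕ n - 1# - deletedDegree x) * I x y - (1# - I x y - S) + 1#
        ≈⟨ solve 4 (λ n d i s → (n :- con (+ 1) :- d) :* i :- (con (+ 1) :- i :- s) :+ con (+ 1) := n :* i :- (d :* i :- s)) refl (fromℕ n) (deletedDegree x) (I x y) S ⟩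
      fromℕ n * I x y - (deletedDegree x * I x y - S)
        ≈⟨ +-congˡ (-‿cong (BBᵀ-formula x y)) ⟨
      fromℕ n * I x y - (B ⊗ B ᵀ) x y  ∎
      where
      S : Carrier
      S = ∑[ α < p ] joins α x y

    -- Each column of B has one entry 1 and one entry -1, at distinct vertices, hence squared length
    -- 2.
    tr-edgeDefect : tr (edgeDefect F) ≈ fromℕ 2 * fromℕ p
    tr-edgeDefect = trans (sum-cong-≋ {p} diagonal) (trans (sum-const p (fromℕ 2)) (*-comm _ _))
      where
      diagonal : ∀ α → edgeDefect F α α ≈ fromℕ 2
      diagonal α = begin
        ∑[ i < n ] ((I i t - I i h) * (I i t - I i h))
          ≈⟨ sum-cong-≋ {n} (λ i → solve 2 (λ a b → (a :- b) :* (a :- b) := (a :- b) :* a :- (a :- b) :* b) refl (I i t) (I i h)) ⟩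
        ∑[ i < n ] ((I i t - I i h) * I i t - (I i t - I i h) * I i h)
          ≈⟨ sum-minus (λ i → (I i t - I i h) * I i t) (λ i → (I i t - I i h) * I i h) ⟩
        ∑[ i < n ] ((I i t - I i h) * I i t) - ∑[ i < n ] ((I i t - I i h) * I i h)
          ≈⟨ +-cong (sum-Iʳ (λ i → I i t - I i h) t) (-‿cong (sum-Iʳ (λ i → I i t - I i h) h)) ⟩
        (I t t - I t h) - (I h t - I h h)
          ≈⟨ +-cong (+-cong (I-≡ {i = t} ≡.refl) (-‿cong (I-≢ (tail≢head α)))) (-‿cong (+-cong (I-≢ (tail≢head α ∘ ≡.sym)) (-‿cong (I-≡ {i = h} ≡.refl)))) ⟩
        (1# - 0#) - (0# - 1#)
          ≈⟨ solve 0 (con (+ 1) :- con (+ 0) :- (con (+ 0) :- con (+ 1)) := con (+ 1) :+ con (+ 1)) refl ⟩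
        1# + 1#
          ≈⟨ fromℕ2≈2# ⟨
        fromℕ 2 ∎
        where
        t h : Fin n
        t = tail α
        h = head α

  -- Kirchhoff index and pseudoinverse of a Laplacian.

  module _ {n : ℕ} (G : SimpleGraph n) where

    open SimpleGraph G

    private
      L A : Matrix n n
      L = laplacian G
      A = laplacian+J G

    laplacian-symmetric : Symmetric L
    laplacian-symmetric x y = +-cong weights (-‿cong (adjacency-symmetric G y x))
      where
      weights : sum (adjacency G y) * I y x ≈ sum (adjacency G x) * I x y
      weights with x ≟ y
      ... | yes ≡.refl = *-congˡ (I-≡ {i = x} ≡.refl)
      ... | no x≢y     = trans (*-congˡ (I-≢ (x≢y ∘ ≡.sym))) (trans (zeroʳ _) (≈-sym (zeroʳ _)))

    laplacian+J-symmetric : Symmetric A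
    laplacian+J-symmetric x y = +-congʳ (laplacian-symmetric x y)

    laplacian-columnSum : ∀ y → ∑[ x < n ] L x y ≈ 0#
    laplacian-columnSum y = trans (sum-cong-≋ {n} (λ x → laplacian-symmetric y x)) (laplacian-rowSum G y)

    module _ (L⁺ : MoorePenrose L) where

      private
        X : Matrix n n
        X = MoorePenrose.matrix L⁺

        R : Fin n → Fin n → Carrier
        R x y = (X x x - X x y) - (X y x - X y y)

        sum-dipole : ∀ (f : Fin n → Carrier) x y → ∑[ i < n ] (f i * (e x i - e y i)) ≈ f x - f y
        sum-dipole f x y = begin
          ∑[ i < n ] (f i * (I i x - I i y))                        ≈⟨ sum-cong-≋ {n} (λ i → solve 3 (λ f a b → f :* (a :- b) := f :* a :- f :* b) refl (f i) (I i x) (I i y)) ⟩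
          ∑[ i < n ] (f i * I i x - f i * I i y)                    ≈⟨ sum-minus (λ i → f i * I i x) (λ i → f i * I i y) ⟩
          ∑[ i < n ] (f i * I i x) - ∑[ i < n ] (f i * I i y)       ≈⟨ +-cong (sum-Iʳ f x) (-‿cong (sum-Iʳ f y)) ⟩
          f x - f y                                                 ∎

        resistance : ∀ x y → effectiveResistance G L⁺ x y ≈ R x y
        resistance x y = begin
          ∑[ i < n ] ∑[ j < n ] (d i * X i j * d j)      ≈⟨ sum-cong-≋ {n} (λ i → sum-dipole (λ j → d i * X i j) x y) ⟩
          ∑[ i < n ] (d i * X i x - d i * X i y)         ≈⟨ sum-cong-≋ {n} (λ i → solve 3 (λ d a b → d :* a :- d :* b := (a :- b) :* d) refl (d i) (X i x) (X i y)) ⟩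
          ∑[ i < n ] ((X i x - X i y) * d i)             ≈⟨ sum-dipole (λ i → X i x - X i y) x y ⟩
          (X x x - X x y) - (X y x - X y y)              ∎
          where
          d : Column n
          d i = e x i - e y i

        upper : Fin n → Fin n → Carrier
        upper x y = if does (x <? y) then R x y else 0#

        upper-yes : ∀ {x y} → toℕ x ℕ.< toℕ y → upper x y ≈ R x y
        upper-yes {x} {y} = if-yes (x <? y)

        upper-no : ∀ {x y} → ¬ (toℕ x ℕ.< toℕ y) → upper x y ≈ 0#
        upper-no {x} {y} = if-no (x <? y)

        -- R is symmetric and zero on the diagonal, so the sum over all ordered pairs is twice the
        -- sum over x < y.
        both : ∀ x y → upper x y + upper y x ≈ R x y
        both x y with <-cmp x y
        ... | tri< x<y _ y≮x = trans (+-cong (upper-yes {x} {y} x<y) (upper-no {y} {x} y≮x)) (+-identityʳ _)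
        ... | tri> x≮y _ y<x = trans (+-cong (upper-no {x} {y} x≮y) (upper-yes {y} {x} y<x))
          (trans (+-identityˡ _) (solve 4 (λ a b c d → (d :- c) :- (b :- a) := (a :- b) :- (c :- d)) refl (X x x) (X x y) (X y x) (X y y)))
        ... | tri≈ x≮y ≡.refl y≮x = trans (+-cong (upper-no {x} {x} x≮y) (upper-no {x} {x} y≮x))
          (solve 1 (λ a → con (+ 0) :+ con (+ 0) := (a :- a) :- (a :- a)) refl (X x x))

        index : kirchhoffIndex G L⁺ ≈ ∑[ x < n ] ∑[ y < n ] upper x y
        index = sum-cong-≋ {n} (λ x → sum-cong-≋ {n} (term x))
          where
          if-cong : ∀ {a} {P : Set a} (P? : Dec P) {r s} → r ≈ s → (if does P? then r else 0#) ≈ (if does P? then s else 0#)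
          if-cong (yes _) r≈s = r≈s
          if-cong (no _)  _   = refl

          term : ∀ x y → (if does (x <? y) then effectiveResistance G L⁺ x y else 0#) ≈ upper x y
          term x y = if-cong (x <? y) (resistance x y)

        total : Carrier
        total = ∑[ x < n ] ∑[ y < n ] X x y

        sum-R : ∑[ x < n ] ∑[ y < n ] R x y ≈ (fromℕ n * tr X - total) + (fromℕ n * tr X - total)
        sum-R = begin
          ∑[ x < n ] ∑[ y < n ] R x y
            ≈⟨ sum-cong-≋ {n} (λ x → trans (sum-minus (λ y → X x x - X x y) (λ y → X y x - X y y))
                 (+-cong (sum-minus (λ _ → X x x) (X x)) (-‿cong (sum-minus (λ y → X y x) (λ y → X y y))))) ⟩
          ∑[ x < n ] ((∑[ y < n ] X x x - ∑[ y < n ] X x y) - (∑[ y < n ] X y x - tr X))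
            ≈⟨ trans (sum-minus (λ x → ∑[ y < n ] X x x - ∑[ y < n ] X x y) (λ x → ∑[ y < n ] X y x - tr X))
                 (+-cong (sum-minus (λ x → ∑[ y < n ] X x x) (λ x → ∑[ y < n ] X x y)) (-‿cong (sum-minus (λ x → ∑[ y < n ] X y x) (λ _ → tr X)))) ⟩
          (∑[ x < n ] ∑[ y < n ] X x x - total) - (∑[ x < n ] ∑[ y < n ] X y x - ∑[ x < n ] tr X)
            ≈⟨ +-cong (+-congʳ (trans (∑-comm {n} {n} (λ x _ → X x x)) (sum-const n (tr X)))) (-‿cong (+-cong (∑-comm (λ x y → X y x)) (-‿cong (sum-const n (tr X))))) ⟩
          (fromℕ n * tr X - total) - (total - fromℕ n * tr X)
            ≈⟨ solve 2 (λ a b → (a :- b) :- (b :- a) := (a :- b) :+ (a :- b)) refl (fromℕ n * tr X) total ⟩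
          (fromℕ n * tr X - total) + (fromℕ n * tr X - total)  ∎

        doubled : kirchhoffIndex G L⁺ + kirchhoffIndex G L⁺ ≈ ∑[ x < n ] ∑[ y < n ] R x y
        doubled = begin
          kirchhoffIndex G L⁺ + kirchhoffIndex G L⁺                                      ≈⟨ +-cong index (trans index (∑-comm upper)) ⟩
          ∑[ x < n ] ∑[ y < n ] upper x y + ∑[ x < n ] ∑[ y < n ] upper y x              ≈⟨ ∑-distrib-+ (λ x → ∑[ y < n ] upper x y) (λ x → ∑[ y < n ] upper y x) ⟨
          ∑[ x < n ] (∑[ y < n ] upper x y + ∑[ y < n ] upper y x)                       ≈⟨ sum-cong-≋ {n} (λ x → ∑-distrib-+ (upper x) (λ y → upper y x)) ⟨
          ∑[ x < n ] ∑[ y < n ] (upper x y + upper y x)                                  ≈⟨ sum-cong-≋ {n} (λ x → sum-cong-≋ {n} (both x)) ⟩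
          ∑[ x < n ] ∑[ y < n ] R x y                                                    ∎

      -- Over all ordered pairs the diagonal entries in R contribute n tr X twice and the mixed ones
      -- the total of X twice. The total remains as a term until the row sums of X are known to
      -- vanish.
      kirchhoffIndex-trace : kirchhoffIndex G L⁺ ≈ fromℕ n * tr (MoorePenrose.matrix L⁺) - ∑[ x < n ] ∑[ y < n ] MoorePenrose.matrix L⁺ x y
      kirchhoffIndex-trace = *-cancelˡ 2#0 (begin
        2# * kirchhoffIndex G L⁺                                ≈⟨ solve 1 (λ k → con (+ 2) :* k := k :+ k) refl (kirchhoffIndex G L⁺) ⟩
        kirchhoffIndex G L⁺ + kirchhoffIndex G L⁺               ≈⟨ trans doubled sum-R ⟩
        (fromℕ n * tr X - total) + (fromℕ n * tr X - total)     ≈⟨ solve 1 (λ k → k :+ k := con (+ 2) :* k) refl (fromℕ n * tr X - total) ⟩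
        2# * (fromℕ n * tr X - total)                           ∎)

    module _ (C : Matrix n n) (AC≋I : A ⊗ C ≋ I) (n#0 : fromℕ n # 0#) where

      private
        n′ ν : Carrier
        n′ = fromℕ n
        ν  = inverse n#0

        n′ν≈1 : n′ * ν ≈ 1#
        n′ν≈1 = *-inverseʳ n#0

        C-symmetric : Symmetric C
        C-symmetric = symmetric-rightInverse laplacian+J-symmetric AC≋I

        CA≋I : C ⊗ A ≋ I
        CA≋I = symmetric-leftInverse laplacian+J-symmetric C-symmetric AC≋I

        A-rowSum : ∀ x → ∑[ y < n ] A x y ≈ n′
        A-rowSum x = begin
          ∑[ y < n ] (L x y + 1#)               ≈⟨ ∑-distrib-+ (L x) (λ _ → 1#) ⟩
          ∑[ y < n ] L x y + ∑[ y < n ] 1#      ≈⟨ +-cong (laplacian-rowSum G x) (trans (sum-const n 1#) (*-identityʳ n′)) ⟩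
          0# + n′                               ≈⟨ +-identityˡ n′ ⟩
          n′                                    ∎

        -- A multiplies the all-ones vector by n, so its inverse C divides it by n.
        C-rowSum : ∀ x → ∑[ y < n ] C x y ≈ ν
        C-rowSum x = *-cancelˡ n#0 (begin
          n′ * ∑[ y < n ] C x y                          ≈⟨ *-comm n′ _ ⟩
          (∑[ y < n ] C x y) * n′                        ≈⟨ *-distribʳ-sum n′ (C x) ⟩
          ∑[ y < n ] (C x y * n′)                        ≈⟨ sum-cong-≋ {n} (λ y → *-congˡ (≈-sym (A-rowSum y))) ⟩
          ∑[ y < n ] (C x y * ∑[ z < n ] A y z)          ≈⟨ sum-cong-≋ {n} (λ y → *-distribˡ-sum (C x y) (A y)) ⟩
          ∑[ y < n ] ∑[ z < n ] (C x y * A y z)          ≈⟨ ∑-comm (λ y z → C x y * A y z) ⟩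
          ∑[ z < n ] (C ⊗ A) x z                         ≈⟨ sum-cong-≋ {n} (CA≋I x) ⟩
          ∑[ z < n ] I x z                               ≈⟨ sum-cong-≋ {n} (λ z → ≈-sym (*-identityʳ (I x z))) ⟩
          ∑[ z < n ] (I x z * 1#)                        ≈⟨ sum-Iˡ (λ _ → 1#) x ⟩
          1#                                             ≈⟨ n′ν≈1 ⟨
          n′ * ν                                         ∎)

        -- On the all-ones vector C acts as ν = 1/n, and so does J/n², since J acts as n.
        -- Subtracting it restores the kernel of L.
        X : Matrix n n
        X x y = C x y - ν * ν

        X-symmetric : Symmetric X
        X-symmetric x y = +-congʳ (C-symmetric x y)

        X-rowSum : ∀ x → ∑[ y < n ] X x y ≈ 0#
        X-rowSum x = begin
          ∑[ y < n ] (C x y - ν * ν)                   ≈⟨ sum-minus (C x) (λ _ → ν * ν) ⟩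
          ∑[ y < n ] C x y - ∑[ y < n ] (ν * ν)        ≈⟨ +-cong (C-rowSum x) (-‿cong (trans (sum-const n (ν * ν)) (≈-sym (*-assoc n′ ν ν)))) ⟩
          ν - n′ * ν * ν                               ≈⟨ +-congˡ (-‿cong (trans (*-congʳ n′ν≈1) (*-identityˡ ν))) ⟩
          ν - ν                                        ≈⟨ -‿inverseʳ ν ⟩
          0#                                           ∎

        centering : Matrix n n
        centering x y = I x y - ν

        centering-symmetric : Symmetric centering
        centering-symmetric x y = +-congʳ (I-sym y x)

        -- The centering matrix I - J/n fixes every matrix with zero column sums. With L X and X L
        -- both equal to it, this covers the first two Penrose equations.
        centering-⊗ : ∀ (P Y : Matrix n n) → P ≋ centering → (∀ y → ∑[ x < n ] Y x y ≈ 0#) → P ⊗ Y ≋ Y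
        centering-⊗ P Y P≋ Y-columnSum x y = begin
          ∑[ z < n ] (P x z * Y z y)                                ≈⟨ sum-cong-≋ {n} (λ z → trans (*-congʳ (P≋ x z)) (solve 3 (λ i v y → (i :- v) :* y := i :* y :- v :* y) refl (I x z) ν (Y z y))) ⟩
          ∑[ z < n ] (I x z * Y z y - ν * Y z y)                    ≈⟨ sum-minus (λ z → I x z * Y z y) (λ z → ν * Y z y) ⟩
          ∑[ z < n ] (I x z * Y z y) - ∑[ z < n ] (ν * Y z y)       ≈⟨ +-cong (sum-Iˡ (λ z → Y z y) x) (-‿cong (trans (≈-sym (*-distribˡ-sum ν (λ z → Y z y))) (*-congˡ (Y-columnSum y)))) ⟩
          Y x y - ν * 0#                                            ≈⟨ solve 2 (λ y v → y :- v :* con (+ 0) := y) refl (Y x y) ν ⟩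
          Y x y                                                     ∎

        -- Write L = A - J. Then L C = I - J C = I - J/n by the column sums of C, and the correction
        -- is killed because L J = 0.
        LX≋centering : L ⊗ X ≋ centering
        LX≋centering x y = begin
          ∑[ z < n ] (L x z * (C z y - ν * ν))
            ≈⟨ sum-cong-≋ {n} (λ z → solve 3 (λ l c v → l :* (c :- v :* v) := ((l :+ con (+ 1)) :* c :- c) :- l :* (v :* v)) refl (L x z) (C z y) ν) ⟩
          ∑[ z < n ] ((A x z * C z y - C z y) - L x z * (ν * ν))
            ≈⟨ trans (sum-minus (λ z → A x z * C z y - C z y) (λ z → L x z * (ν * ν))) (+-congʳ (sum-minus (λ z → A x z * C z y) (λ z → C z y))) ⟩
          ((A ⊗ C) x y - ∑[ z < n ] C z y) - ∑[ z < n ] (L x z * (ν * ν))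
            ≈⟨ +-cong (+-cong (AC≋I x y) (-‿cong (trans (sum-cong-≋ {n} (λ z → C-symmetric y z)) (C-rowSum y))))
                 (-‿cong (trans (≈-sym (*-distribʳ-sum (ν * ν) (L x))) (trans (*-congʳ (laplacian-rowSum G x)) (zeroˡ _)))) ⟩
          (I x y - ν) - 0#
            ≈⟨ x-0≈x _ ⟩
          I x y - ν  ∎

        XL≋centering : X ⊗ L ≋ centering
        XL≋centering x y = begin
          (X ⊗ L) x y       ≈⟨ ⊗-cong X-symmetric laplacian-symmetric x y ⟨
          (X ᵀ ⊗ L ᵀ) x y   ≈⟨ ⊗-ᵀ L X x y ⟨
          (L ⊗ X) y x       ≈⟨ LX≋centering y x ⟩
          I y x - ν         ≈⟨ centering-symmetric x y ⟩
          I x y - ν         ∎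

        symm : ∀ {P : Matrix n n} → P ≋ centering → P ᵀ ≋ P
        symm P≋ x y = trans (P≋ y x) (trans (centering-symmetric x y) (≈-sym (P≋ x y)))

      pseudoinverse : MoorePenrose L
      pseudoinverse = record
        { matrix  = X
        ; AXA≋A   = centering-⊗ (L ⊗ X) L LX≋centering laplacian-columnSum
        ; XAX≋X   = centering-⊗ (X ⊗ L) X XL≋centering (λ y → trans (sum-cong-≋ {n} (λ x → X-symmetric y x)) (X-rowSum y))
        ; AX-symm = symm LX≋centering
        ; XA-symm = symm XL≋centering
        }

      kirchhoffIndex-inverse : kirchhoffIndex G pseudoinverse ≈ fromℕ n * tr C - 1#
      kirchhoffIndex-inverse = begin
        kirchhoffIndex G pseudoinverse                          ≈⟨ kirchhoffIndex-trace pseudoinverse ⟩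
        n′ * tr X - ∑[ x < n ] ∑[ y < n ] X x y                 ≈⟨ +-congˡ (-‿cong (sum-zero (λ x → ∑[ y < n ] X x y) X-rowSum)) ⟩
        n′ * tr X - 0#                                          ≈⟨ x-0≈x _ ⟩
        n′ * tr X                                               ≈⟨ *-congˡ (trans (sum-minus (λ x → C x x) (λ _ → ν * ν)) (+-congˡ (-‿cong (sum-const n (ν * ν))))) ⟩
        n′ * (tr C - n′ * (ν * ν))                              ≈⟨ solve 3 (λ n t v → n :* (t :- n :* (v :* v)) := n :* t :- (n :* v) :* (n :* v)) refl n′ (tr C) ν ⟩
        n′ * tr C - (n′ * ν) * (n′ * ν)                         ≈⟨ +-congˡ (-‿cong (trans (*-cong n′ν≈1 n′ν≈1) (*-identityˡ 1#))) ⟩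
        n′ * tr C - 1#                                          ∎

  -- The edge-defect matrix

  -- (n I - Bᵀ B)⁻¹ = (I + Bᵀ (n I - B Bᵀ)⁻¹ B) / n.
  module PushThrough {m p : ℕ} (B : Matrix m p) (n′ : Carrier) (0<n′ : 0# < n′) (A C : Matrix m m)
                     (A≋ : A ≋ n′ ⊙ I ⊖ B ⊗ B ᵀ) (AC≋I : A ⊗ C ≋ I) (A-nonNeg : ∀ u → NonNegative (u ∙ (A ⊛ u))) where

    private
      n#0 : n′ # 0#
      n#0 = >⇒#0 0<n′

      ν : Carrier
      ν = inverse n#0

      n′ν≈1 : n′ * ν ≈ 1#
      n′ν≈1 = *-inverseʳ n#0

      Q S N : Matrix p p
      Q = B ᵀ ⊗ B
      S = B ᵀ ⊗ C ⊗ B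
      N = n′ ⊙ I ⊖ Q

      BBᵀC≋ : B ⊗ B ᵀ ⊗ C ≋ n′ ⊙ C ⊖ I
      BBᵀC≋ i j = begin
        (B ⊗ B ᵀ ⊗ C) i j                                       ≈⟨ solve 2 (λ a b → b := a :- (a :- b)) refl (n′ * C i j) ((B ⊗ B ᵀ ⊗ C) i j) ⟩
        n′ * C i j - (n′ * C i j - (B ⊗ B ᵀ ⊗ C) i j)           ≈⟨ +-congˡ (-‿cong ([⊙I⊖]⊗ n′ (B ⊗ B ᵀ) C i j)) ⟨
        n′ * C i j - ((n′ ⊙ I ⊖ B ⊗ B ᵀ) ⊗ C) i j               ≈⟨ +-congˡ (-‿cong (trans (≈-sym (⊗-congʳ C A≋ i j)) (AC≋I i j))) ⟩
        n′ * C i j - I i j                                      ∎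

      -- Reassociating Bᵀ B Bᵀ C B exposes the block B Bᵀ C in the middle, which `BBᵀC≋` replaces by
      -- n C - I.
      QS≋ : Q ⊗ S ≋ n′ ⊙ S ⊖ Q
      QS≋ i j = begin
        (B ᵀ ⊗ B ⊗ (B ᵀ ⊗ C ⊗ B)) i j                     ≈⟨ ⊗-assoc (B ᵀ) B (B ᵀ ⊗ C ⊗ B) i j ⟩
        (B ᵀ ⊗ (B ⊗ (B ᵀ ⊗ C ⊗ B))) i j                   ≈⟨ ⊗-congˡ (B ᵀ) inner i j ⟩
        (B ᵀ ⊗ (n′ ⊙ (C ⊗ B) ⊖ B)) i j                    ≈⟨ ⊗-⊙⊖ (B ᵀ) n′ (C ⊗ B) B i j ⟩
        n′ * (B ᵀ ⊗ (C ⊗ B)) i j - Q i j                  ≈⟨ +-congʳ (*-congˡ (⊗-assoc (B ᵀ) C B i j)) ⟨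
        n′ * S i j - Q i j                                ∎
        where
        inner : B ⊗ (B ᵀ ⊗ C ⊗ B) ≋ n′ ⊙ (C ⊗ B) ⊖ B
        inner k l = begin
          (B ⊗ (B ᵀ ⊗ C ⊗ B)) k l         ≈⟨ ⊗-assoc B (B ᵀ ⊗ C) B k l ⟨
          (B ⊗ (B ᵀ ⊗ C) ⊗ B) k l         ≈⟨ ⊗-congʳ B (λ r s → ≈-sym (⊗-assoc B (B ᵀ) C r s)) k l ⟩
          (B ⊗ B ᵀ ⊗ C ⊗ B) k l           ≈⟨ ⊗-congʳ B BBᵀC≋ k l ⟩
          ((n′ ⊙ C ⊖ I) ⊗ B) k l          ≈⟨ ⊙⊖-⊗ n′ C I B k l ⟩
          n′ * (C ⊗ B) k l - (I ⊗ B) k l  ≈⟨ +-congˡ (-‿cong (⊗-identityˡ B k l)) ⟩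
          n′ * (C ⊗ B) k l - B k l        ∎

    gramInverse : Matrix p p
    gramInverse i j = ν * (I i j + S i j)

    private
      M : Matrix p p
      M = gramInverse

    N⊗M≋I : N ⊗ M ≋ I
    N⊗M≋I i j = begin
      (N ⊗ M) i j
        ≈⟨ [⊙I⊖]⊗ n′ Q M i j ⟩
      n′ * (ν * (I i j + S i j)) - (Q ⊗ M) i j
        ≈⟨ +-congˡ (-‿cong QM) ⟩
      n′ * (ν * (I i j + S i j)) - ν * (n′ * S i j)
        ≈⟨ solve 4 (λ n v i s → n :* (v :* (i :+ s)) :- v :* (n :* s) := n :* v :* i) refl n′ ν (I i j) (S i j) ⟩
      n′ * ν * I i j
        ≈⟨ trans (*-congʳ n′ν≈1) (*-identityˡ _) ⟩
      I i j  ∎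
      where
      QM : (Q ⊗ M) i j ≈ ν * (n′ * S i j)
      QM = begin
        ∑[ k < p ] (Q i k * (ν * (I k j + S k j)))                      ≈⟨ sum-cong-≋ {p} (λ k → solve 4 (λ q v i s → q :* (v :* (i :+ s)) := v :* (q :* i :+ q :* s)) refl (Q i k) ν (I k j) (S k j)) ⟩
        ∑[ k < p ] (ν * (Q i k * I k j + Q i k * S k j))                ≈⟨ *-distribˡ-sum ν (λ k → Q i k * I k j + Q i k * S k j) ⟨
        ν * ∑[ k < p ] (Q i k * I k j + Q i k * S k j)                  ≈⟨ *-congˡ (∑-distrib-+ (λ k → Q i k * I k j) (λ k → Q i k * S k j)) ⟩
        ν * (∑[ k < p ] (Q i k * I k j) + (Q ⊗ S) i j)                  ≈⟨ *-congˡ (+-cong (sum-Iʳ (Q i) j) (QS≋ i j)) ⟩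
        ν * (Q i j + (n′ * S i j - Q i j))                              ≈⟨ *-congˡ (solve 2 (λ q s → q :+ (s :- q) := s) refl (Q i j) (n′ * S i j)) ⟩
        ν * (n′ * S i j)                                                ∎

    private
      N-symmetric : Symmetric N
      N-symmetric i j = +-cong (*-congˡ (I-sym j i)) (-‿cong (⊗-ᵀ (B ᵀ) B i j))

    M⊗N≋I : M ⊗ N ≋ I
    M⊗N≋I = symmetric-leftInverse N-symmetric (symmetric-rightInverse N-symmetric N⊗M≋I) N⊗M≋I

    -- Cyclicity of the trace turns tr (Bᵀ C B) into tr (B Bᵀ C) = tr (n C - I), passing from size p
    -- to size m.
    tr-gramInverse : n′ * tr M ≈ fromℕ p + (n′ * tr C - fromℕ m)
    tr-gramInverse = begin
      n′ * tr M                                       ≈⟨ *-congˡ (≈-sym (*-distribˡ-sum ν (λ i → I i i + S i i))) ⟩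
      n′ * (ν * ∑[ i < p ] (I i i + S i i))           ≈⟨ trans (≈-sym (*-assoc n′ ν _)) (trans (*-congʳ n′ν≈1) (*-identityˡ _)) ⟩
      ∑[ i < p ] (I i i + S i i)                      ≈⟨ ∑-distrib-+ {p} (λ i → I i i) (λ i → S i i) ⟩
      tr (I {p}) + tr S                               ≈⟨ +-cong (tr-I p) tr-S ⟩
      fromℕ p + (n′ * tr C - fromℕ m)                 ∎
      where
      tr-S : tr S ≈ n′ * tr C - fromℕ m
      tr-S = begin
        tr (B ᵀ ⊗ C ⊗ B)        ≈⟨ tr-⊗-comm (B ᵀ ⊗ C) B ⟩
        tr (B ⊗ (B ᵀ ⊗ C))      ≈⟨ sum-cong-≋ {m} (λ i → trans (≈-sym (⊗-assoc B (B ᵀ) C i i)) (BBᵀC≋ i i)) ⟩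
        tr (n′ ⊙ C ⊖ I)         ≈⟨ trans (tr-⊙⊖ n′ C I) (+-congˡ (-‿cong (tr-I m))) ⟩
        n′ * tr C - fromℕ m     ∎

    -- With y = N x, the form xᵀ N x equals yᵀ M y.
    gram-positiveDefinite : PositiveDefinite N
    gram-positiveDefinite x (i , xᵢ#0) = <-respʳ-≈ (≈-sym form) (*-pos 0<ν (pos+nonNeg 0<y∙y S-nonNeg))
      where
      y : Column p
      y = N ⊛ x

      z w : Column m
      z = B ⊛ y
      w = C ⊛ z

      My≈x : ∀ j → (M ⊛ y) j ≈ x j
      My≈x j = begin
        (M ⊛ (N ⊛ x)) j    ≈⟨ ⊛-assoc M N x j ⟨
        (M ⊗ N ⊛ x) j      ≈⟨ ⊛-congʳ x M⊗N≋I j ⟩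
        (I ⊛ x) j          ≈⟨ sum-Iˡ x j ⟩
        x j                ∎

      yₖ#0 : ∃[ k ] y k # 0#
      yₖ#0 = proj₁ Mᵢₖyₖ#0 , *-#0ʳ {M i (proj₁ Mᵢₖyₖ#0)} {y (proj₁ Mᵢₖyₖ#0)} (proj₂ Mᵢₖyₖ#0)
        where
        Mᵢₖyₖ#0 : ∃[ k ] M i k * y k # 0#
        Mᵢₖyₖ#0 = sum-#0 (λ k → M i k * y k) (#-congʳ (≈-sym (My≈x i)) xᵢ#0)

      0<y∙y : 0# < y ∙ y
      0<y∙y = sum-pos (λ k → y k * y k) (λ k → square-nonNeg (y k)) (proj₁ yₖ#0) (x#0⇒0<x² {y (proj₁ yₖ#0)} (proj₂ yₖ#0))

      0<ν : 0# < ν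
      0<ν = <-respʳ-≈ (trans (solve 2 (λ n v → v :* v :* n := n :* v :* v) refl n′ ν) (trans (*-congʳ n′ν≈1) (*-identityˡ ν)))
        (*-pos (x#0⇒0<x² (*-#0ʳ (#-congʳ (≈-sym n′ν≈1) 1#0))) 0<n′)

      S-form : y ∙ (S ⊛ y) ≈ w ∙ (A ⊛ w)
      S-form = begin
        y ∙ (S ⊛ y)              ≈⟨ sum-cong-≋ {p} (λ j → *-congˡ {y j} (trans (⊛-assoc (B ᵀ ⊗ C) B y j) (⊛-assoc (B ᵀ) C z j))) ⟩
        y ∙ (B ᵀ ⊛ w)            ≈⟨ ∙-transpose B y w ⟩
        z ∙ w                    ≈⟨ sum-cong-≋ {m} (λ k → trans (*-comm (z k) (w k)) (*-congˡ (≈-sym (Aw≈z k)))) ⟩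
        w ∙ (A ⊛ w)              ∎
        where
        Aw≈z : ∀ k → (A ⊛ w) k ≈ z k
        Aw≈z k = begin
          (A ⊛ (C ⊛ z)) k    ≈⟨ ⊛-assoc A C z k ⟨
          (A ⊗ C ⊛ z) k      ≈⟨ ⊛-congʳ z AC≋I k ⟩
          (I ⊛ z) k          ≈⟨ sum-Iˡ z k ⟩
          z k                ∎

      S-nonNeg : NonNegative (y ∙ (S ⊛ y))
      S-nonNeg = NonNegative-resp-≈ (≈-sym S-form) (A-nonNeg w)

      apply : ∀ j → (M ⊛ y) j ≈ ν * (y j + (S ⊛ y) j)
      apply j = begin
        ∑[ k < p ] (ν * (I j k + S j k) * y k)                   ≈⟨ sum-cong-≋ {p} (λ k → solve 4 (λ v i s y → v :* (i :+ s) :* y := v :* (i :* y :+ s :* y)) refl ν (I j k) (S j k) (y k)) ⟩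
        ∑[ k < p ] (ν * (I j k * y k + S j k * y k))             ≈⟨ *-distribˡ-sum ν (λ k → I j k * y k + S j k * y k) ⟨
        ν * ∑[ k < p ] (I j k * y k + S j k * y k)               ≈⟨ *-congˡ (trans (∑-distrib-+ (λ k → I j k * y k) (λ k → S j k * y k)) (+-congʳ (sum-Iˡ y j))) ⟩
        ν * (y j + (S ⊛ y) j)                                    ∎

      form : x ∙ y ≈ ν * (y ∙ y + y ∙ (S ⊛ y))
      form = begin
        ∑[ j < p ] (x j * y j)                                   ≈⟨ sum-cong-≋ {p} (λ j → trans (*-congʳ (trans (≈-sym (My≈x j)) (apply j))) (solve 3 (λ v y s → v :* (y :+ s) :* y := v :* (y :* y :+ y :* s)) refl ν (y j) ((S ⊛ y) j))) ⟩
        ∑[ j < p ] (ν * (y j * y j + y j * (S ⊛ y) j))           ≈⟨ *-distribˡ-sum ν (λ j → y j * y j + y j * (S ⊛ y) j) ⟨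
        ν * ∑[ j < p ] (y j * y j + y j * (S ⊛ y) j)             ≈⟨ *-congˡ (∑-distrib-+ (λ j → y j * y j) (λ j → y j * (S ⊛ y) j)) ⟩
        ν * (y ∙ y + y ∙ (S ⊛ y))                                ∎

  -- Q - t I = (a - t) I - N, so (Q - t I)² M = (a - t) ((a - t) M - I) - (Q - t I).
  tr-shiftedSquare : ∀ {p} (Q M : Matrix p p) a t → (a ⊙ I ⊖ Q) ⊗ M ≋ I → tr Q ≈ t * fromℕ p →
                     tr ((Q ⊖ t ⊙ I) ⊗ (Q ⊖ t ⊙ I) ⊗ M) ≈ (a - t) * ((a - t) * tr M - fromℕ p)
  tr-shiftedSquare {p} Q M a t NM≋I trQ≈ = begin
    tr (Q′ ⊗ Q′ ⊗ M)                                        ≈⟨ sum-cong-≋ {p} (λ i → square i i) ⟩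
    tr (q ⊙ (q ⊙ M ⊖ I) ⊖ Q′)                               ≈⟨ tr-⊙⊖ q (q ⊙ M ⊖ I) Q′ ⟩
    q * tr (q ⊙ M ⊖ I) - tr Q′                              ≈⟨ +-cong (*-congˡ (trans (tr-⊙⊖ q M I) (+-congˡ (-‿cong (tr-I p))))) (-‿cong trQ′) ⟩
    q * (q * tr M - fromℕ p) - 0#                           ≈⟨ x-0≈x _ ⟩
    q * (q * tr M - fromℕ p)                                ∎
    where
    q : Carrier
    q = a - t

    Q′ : Matrix p p
    Q′ = Q ⊖ t ⊙ I

    trQ′ : tr Q′ ≈ 0#
    trQ′ = begin
      tr Q′                                                 ≈⟨ sum-minus (λ i → Q i i) (λ i → t * I i i) ⟩
      tr Q - ∑[ i < p ] (t * I i i)                         ≈⟨ +-cong trQ≈ (-‿cong (trans (≈-sym (*-distribˡ-sum {p} t (λ i → I i i))) (*-congˡ (tr-I p)))) ⟩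
      t * fromℕ p - t * fromℕ p                             ≈⟨ -‿inverseʳ _ ⟩
      0#                                                    ∎

    once : Q′ ⊗ M ≋ q ⊙ M ⊖ I
    once i j = begin
      (Q′ ⊗ M) i j                                          ≈⟨ ⊗-congʳ M (λ i j → solve 4 (λ a t q i → q :- t :* i := (a :- t) :* i :- (a :* i :- q)) refl a t (Q i j) (I i j)) i j ⟩
      ((q ⊙ I ⊖ (a ⊙ I ⊖ Q)) ⊗ M) i j                       ≈⟨ [⊙I⊖]⊗ q (a ⊙ I ⊖ Q) M i j ⟩
      q * M i j - ((a ⊙ I ⊖ Q) ⊗ M) i j                     ≈⟨ +-congˡ (-‿cong (NM≋I i j)) ⟩
      q * M i j - I i j                                     ∎

    square : Q′ ⊗ Q′ ⊗ M ≋ q ⊙ (q ⊙ M ⊖ I) ⊖ Q′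
    square i j = begin
      (Q′ ⊗ Q′ ⊗ M) i j                                     ≈⟨ ⊗-assoc Q′ Q′ M i j ⟩
      (Q′ ⊗ (Q′ ⊗ M)) i j                                   ≈⟨ ⊗-congˡ Q′ once i j ⟩
      (Q′ ⊗ (q ⊙ M ⊖ I)) i j                                ≈⟨ ⊗-⊙⊖ Q′ q M I i j ⟩
      q * (Q′ ⊗ M) i j - (Q′ ⊗ I) i j                       ≈⟨ +-cong (*-congˡ (once i j)) (-‿cong (⊗-identityʳ Q′ i j)) ⟩
      q * (q * M i j - I i j) - Q′ i j                      ∎

  -- The scalar counterpart of `tr-shiftedSquare`, with θ for Q and y for M. The right-hand sides
  -- have the same shape, so equal values of `sum y` and tr M make the two formulas agree.
  sum-shiftedSquare : ∀ {p} a t (θ y : Fin p → Carrier) → (∀ α → (a - θ α) * y α ≈ 1#) → sum θ ≈ t * fromℕ p →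
                      ∑[ α < p ] ((θ α - t) ^ 2 * y α) ≈ (a - t) * ((a - t) * sum y - fromℕ p)
  sum-shiftedSquare {p} a t θ y δy≈1 ∑θ≈ = begin
    ∑[ α < p ] ((θ α - t) ^ 2 * y α)                            ≈⟨ sum-cong-≋ {p} term ⟩
    ∑[ α < p ] (q * q * y α - (θ α + (q - t)))                  ≈⟨ sum-minus (λ α → q * q * y α) (λ α → θ α + (q - t)) ⟩
    ∑[ α < p ] (q * q * y α) - ∑[ α < p ] (θ α + (q - t))       ≈⟨ +-cong (≈-sym (*-distribˡ-sum (q * q) y)) (-‿cong (trans (∑-distrib-+ θ (λ _ → q - t)) (+-cong ∑θ≈ (sum-const p (q - t))))) ⟩
    q * q * sum y - (t * fromℕ p + fromℕ p * (q - t))           ≈⟨ solve 4 (λ q t s p → q :* q :* s :- (t :* p :+ p :* (q :- t)) := q :* (q :* s :- p)) refl q t (sum y) (fromℕ p) ⟩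
    q * (q * sum y - fromℕ p)                                   ∎
    where
    q : Carrier
    q = a - t

    -- (θ - t)² = ((a - t) - δ)² with δ = a - θ and δ y = 1.
    term : ∀ α → (θ α - t) ^ 2 * y α ≈ q * q * y α - (θ α + (q - t))
    term α = begin
      (θ α - t) * ((θ α - t) * 1#) * y α
        ≈⟨ solve 4 (λ a t x y → (x :- t) :* ((x :- t) :* con (+ 1)) :* y := (a :- t) :* (a :- t) :* y :- (con (+ 2) :* (a :- t) :- (a :- x)) :* ((a :- x) :* y)) refl a t (θ α) (y α) ⟩
      q * q * y α - (2# * q - (a - θ α)) * ((a - θ α) * y α)
        ≈⟨ +-congˡ (-‿cong (*-congˡ (δy≈1 α))) ⟩
      q * q * y α - (2# * q - (a - θ α)) * 1#
        ≈⟨ solve 4 (λ a t x z → z :- (con (+ 2) :* (a :- t) :- (a :- x)) :* con (+ 1) := z :- (x :+ ((a :- t) :- t))) refl a t (θ α) (q * q * y α) ⟩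
      q * q * y α - (θ α + (q - t))  ∎

  -- q stands for n - 2, i and k for the inverses of q and q², c for n tr C.
  kirchhoffFormula : ∀ {n t p T q i k kf c} → q ≈ n - t → q * i ≈ 1# → q ^ 2 * k ≈ 1# →
            n * T ≈ p + (c - n) → kf ≈ c - 1# → kf ≈ n - 1# + t * p * i + n * k * (q * (q * T - p))
  kirchhoffFormula {n} {t} {p} {T} {q} {i} {k} {kf} {c} q≈ qi≈1 q²k≈1 nT≈ kf≈ = begin
    kf                                                       ≈⟨ kf≈ ⟩
    c - 1#                                                   ≈⟨ solve 3 (λ n p c → c :- con (+ 1) := n :- con (+ 1) :+ (p :+ (c :- n) :- p)) refl n p c ⟩
    n - 1# + ((p + (c - n)) - p)                             ≈⟨ +-congˡ (+-congʳ nT≈) ⟨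
    n - 1# + (n * T - p)                                     ≈⟨ solve 3 (λ n T p → n :- con (+ 1) :+ (n :* T :- p) := n :- con (+ 1) :+ (n :* con (+ 1) :* T :- con (+ 1) :* p)) refl n T p ⟩
    n - 1# + (n * 1# * T - 1# * p)                           ≈⟨ +-congˡ (+-cong (*-congʳ (*-congˡ q²k≈1)) (-‿cong (*-congʳ qi≈1))) ⟨
    n - 1# + (n * (q ^ 2 * k) * T - q * i * p)               ≈⟨ +-congˡ (+-congˡ (-‿cong (*-congʳ (*-congʳ q≈)))) ⟩
    n - 1# + (n * (q ^ 2 * k) * T - (n - t) * i * p)         ≈⟨ solve 7 (λ n t p T q i k → n :- con (+ 1) :+ (n :* (q :* (q :* con (+ 1)) :* k) :* T :- (n :- t) :* i :* p)
                                                                  := n :- con (+ 1) :+ t :* p :* i :+ (n :* k :* (q :* (q :* T)) :- n :* i :* p)) refl n t p T q i k ⟩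
    n - 1# + t * p * i + (n * k * (q * (q * T)) - n * i * p)        ≈⟨ +-congˡ (+-congˡ (-‿cong (*-congʳ (*-congˡ i≈qk)))) ⟩
    n - 1# + t * p * i + (n * k * (q * (q * T)) - n * (q * k) * p)  ≈⟨ +-congˡ (solve 5 (λ n p T q k → n :* k :* (q :* (q :* T)) :- n :* (q :* k) :* p := n :* k :* (q :* (q :* T :- p))) refl n p T q k) ⟩
    n - 1# + t * p * i + n * k * (q * (q * T - p))           ∎
    where
    i≈qk : i ≈ q * k
    i≈qk = begin
      i                          ≈⟨ *-identityˡ i ⟨
      1# * i                     ≈⟨ *-congʳ q²k≈1 ⟨
      q * (q * 1#) * k * i       ≈⟨ solve 3 (λ q k i → q :* (q :* con (+ 1)) :* k :* i := q :* k :* (q :* i)) refl q k i ⟩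
      q * k * (q * i)            ≈⟨ *-congˡ qi≈1 ⟩
      q * k * 1#                 ≈⟨ *-identityʳ _ ⟩
      q * k                      ∎

  -- The trace formula and the eigenvalue formula.

  module _ {n p : ℕ} (3≤n : 3 ≤ n) (F : OrientedEdges (complete n) p) (connected : Connected (complete n ∖ F)) where

    private
      G : SimpleGraph n
      G = complete n ∖ F

      B : Matrix n p
      B = incidence F

      Q : Matrix p p
      Q = edgeDefect F

      n′ t q affine scale : Carrier
      n′ = fromℕ n
      t  = fromℕ 2
      q  = n′ - t
      affine = n′ - 1# + t * fromℕ p / q ⟨ n-2#0 3≤n ⟩
      scale  = n′ / q ^ 2 ⟨ [n-2]²#0 3≤n ⟩

      0<n′ : 0# < n′
      0<n′ = positive 3≤n
        where
        positive : ∀ {n} → 3 ≤ n → 0# < fromℕ n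
        positive {suc n} _ = 0<fromℕ n

      A-inverse : Σ[ C ∈ Matrix n n ] laplacian+J G ⊗ C ≋ I
      A-inverse = positiveDefinite⇒rightInverse (laplacian+J G) (laplacian+J-positiveDefinite G connected (>⇒#0 0<n′))

      C : Matrix n n
      C = proj₁ A-inverse

      AC≋I : laplacian+J G ⊗ C ≋ I
      AC≋I = proj₂ A-inverse

      open PushThrough B n′ 0<n′ (laplacian+J G) C (laplacian+J-formula F) AC≋I (laplacian+J-nonNeg G)

      M : Matrix p p
      M = gramInverse

      det#0 : det (n′ ⊙ I ⊖ Q) # 0#
      det#0 = positiveDefinite⇒det#0 (n′ ⊙ I ⊖ Q) gram-positiveDefinite

    kirchhoffPseudoinverse : MoorePenrose (laplacian G)
    kirchhoffPseudoinverse = pseudoinverse G C AC≋I (>⇒#0 0<n′)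

    defectInverse : Inverse (n′ ⊙ I ⊖ Q)
    defectInverse = record
      { matrix   = M
      ; inverseˡ = M⊗N≋I
      ; inverseʳ = N⊗M≋I
      }

    private
      -- Here z is the trace in one formula and the sum over eigenvalues in the other; both reduce
      -- to the same expression in tr M.
      kirchhoff : ∀ {z} → z ≈ q * (q * tr M - fromℕ p) → kirchhoffIndex G kirchhoffPseudoinverse ≈ affine + scale * z
      kirchhoff z≈ = trans
        (kirchhoffFormula refl (*-inverseʳ (n-2#0 3≤n)) (*-inverseʳ ([n-2]²#0 3≤n))
          tr-gramInverse
          (kirchhoffIndex-inverse G C AC≋I (>⇒#0 0<n′)))
        (+-congˡ (*-congˡ (≈-sym z≈)))

    kirchhoffIndex-trace-formula : kirchhoffIndex G kirchhoffPseudoinverse ≈ affine + scale * tr ((Q ⊖ t ⊙ I) ⊗ (Q ⊖ t ⊙ I) ⊗ M)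
    kirchhoffIndex-trace-formula = kirchhoff (tr-shiftedSquare Q M n′ t N⊗M≋I (tr-edgeDefect F))

    -- That each n - θ is apart from zero is part of the conclusion: their product is det (n I - Q),
    -- which positive definiteness keeps apart from zero.
    kirchhoffIndex-eigenvalue-formula : ∀ θ → Eigenvalues Q θ → Σ[ n-θ#0 ∈ (∀ α → n′ - θ α # 0#) ]
      kirchhoffIndex G kirchhoffPseudoinverse ≈ affine + scale * ∑[ α < p ] ((θ α - t) ^ 2 / n′ - θ α ⟨ n-θ#0 α ⟩)
    kirchhoffIndex-eigenvalue-formula θ eig = n-θ#0 , kirchhoff (trans
      (sum-shiftedSquare n′ t θ y δy≈1 (trans (eigenvalues-sum Q θ eig) (tr-edgeDefect F)))
      (*-congˡ (+-congʳ (*-congˡ (eigenvalues-sum-inverse Q θ eig n′ det#0 M N⊗M≋I y δy≈1)))))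
      where
      n-θ#0 : ∀ α → n′ - θ α # 0#
      n-θ#0 = eigenvalues-#0 Q θ eig n′ det#0

      y : Fin p → Carrier
      y α = inverse (n-θ#0 α)

      δy≈1 : ∀ α → (n′ - θ α) * y α ≈ 1#
      δy≈1 α = *-inverseʳ (n-θ#0 α)

theorem5p1 :
  ∀ {c ℓ₁ ℓ₂ ℓ₃} (K : OrderedField c ℓ₁ ℓ₂ ℓ₃) →
  let open OrderedField K
      open Over K
  in
  ∀ {n p : ℕ} (3≤n : 3 ≤ n) → 1 ≤ p →
  (F : OrientedEdges (complete n) p) →
  Connected (complete n ∖ F) →
  let G      = complete n ∖ F
      Q      = edgeDefect F
      Q-2I   = Q ⊖ fromℕ 2 ⊙ I
      n′     = fromℕ n
      n-2    = n′ - fromℕ 2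
      affine = n′ - 1# + fromℕ 2 * fromℕ p / n-2 ⟨ n-2#0 3≤n ⟩
      scale  = n′ / n-2 ^ 2 ⟨ [n-2]²#0 3≤n ⟩
  in
  Σ[ L⁺ ∈ MoorePenrose (laplacian G) ]
  Σ[ M ∈ Inverse (n′ ⊙ I ⊖ Q) ]
    kirchhoffIndex G L⁺ ≈ affine + scale *
      tr (Q-2I ⊗ Q-2I ⊗ Inverse.matrix M)
  × (∀ (θ : Fin p → Carrier) → Eigenvalues Q θ →
     Σ[ n-θ#0 ∈ (∀ α → n′ - θ α # 0#) ]
     kirchhoffIndex G L⁺ ≈ affine + scale *
       (∑[ α < p ] ((θ α - fromℕ 2) ^ 2 / n′ - θ α ⟨ n-θ#0 α ⟩)))
theorem5p1 K 3≤n _ F connected =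
  kirchhoffPseudoinverse K 3≤n F connected ,
  defectInverse K 3≤n F connected ,
  kirchhoffIndex-trace-formula K 3≤n F connected ,
  kirchhoffIndex-eigenvalue-formula K 3≤n F connected
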